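{- Let $n$ be a sufficiently large positive integer and $u$ an integer with $n^{6}\le u\le n^{C}$ for a fixed constant $C$. Let $M_{\mathcal{R}\mathsf{H}}$ be the maximum, over $n$-element sets $X\subset[\lfloor\sqrt{nu}\rfloor]$, of the expected maxload of $\mathcal{R}\mathsf{H}_{\lfloor\sqrt{nu}\rfloor}$ on $X$; let $M_{\max}$ be the maximum over integers $k\in(\sqrt{u},nu]$ of $M_{\mathsf{SH}}(k,n)$; and let $M_{\mathbb{R}}$ be the maximum, over $n$-element sets $X\subset[u]$, of the expected maxload of $\mathbb{R}\mathsf{H}_u$ on $X$. Then \[ \Omega\!\left(\frac{M_{\mathcal{R}\mathsf{H}}}{\log\log n}\right)\le M_{\mathbb{R}}\le \mathcal{O}(M_{\max}). \]
   Context: $[N]=\{0,\dots,N-1\}$; for positive integer $N$ and real $x$, $\mathfrak{m}_N(x)$ is the unique element of $(x+N\mathbb{Z})\cap[0,N)$; $\mathbb{Z}_N^{\times}$ is the set of $k\in[N]$ coprime to $N$. All hash functions below map into $n$ bins $[n]$; the maxload on a set $X$ is the number of elements of $X$ in the fullest bin. - $\mathsf{SH}_k$: choose $c$ uniformly from $\mathbb{Z}_k^{\times}$ and place $x$ in bin $\lfloor \mathfrak{m}_k(cx)/(k/n)\rfloor$. $M_{\mathsf{SH}}(k,n)$ is the maximum over $n$-element $X\subset[k]$ of the expected maxload of $\mathsf{SH}_k$ on $X$. - $\mathcal{R}\mathsf{H}_m$ (random-modulus hashing): choose an integer $k$ uniformly from $[m/2,m]\cap\mathbb{Z}$, then hash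 with $\mathsf{SH}_k$'s hash function (random $c\in\mathbb{Z}_k^{\times}$, $x\mapsto\lfloor\mathfrak{m}_k(cx)/(k/n)\rfloor$). - $\mathbb{R}\mathsf{H}_u$ (real hashing): choose a real $a$ uniformly from $(0,1)$ and place $x\in[u]$ in bin $\lfloor \mathfrak{m}_1(ax)/(1/n)\rfloor$. -}

module Defs where

open import Data.Nat as ℕ using (ℕ; zero; suc; _≟_; _≤?_; _<?_)
open import Data.Nat.DivMod using (_/_; _%_)
open import Data.Nat.GCD using (gcd)
open import Data.Nat.Logarithm using (⌊log₂_⌋)
open import Data.Integer using (+_; ∣_∣)
open import Data.Rational as ℚ using (ℚ; 0ℚ; ↥_)
open import Data.Rational.Properties using (≤-decTotalOrder)
open import Data.List using (List; []; _∷_; _++_; map; filter; length; foldr; upTo; concatMap; applyUpTo)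
import Data.List.Sort

open Data.List.Sort ≤-decTotalOrder using (sort)

ℕtoℚ : ℕ → ℚ
ℕtoℚ m = (+ m) ℚ./ 1

-- maximum of a list of rationals (0 for the empty list; all values used are ≥ 0)
maxℚ : List ℚ → ℚ
maxℚ = foldr ℚ._⊔_ 0ℚ

sumℚ : List ℚ → ℚ
sumℚ = foldr ℚ._+_ 0ℚ

avgℚ : List ℚ → ℚ
avgℚ [] = 0ℚ
avgℚ (q ∷ qs) = sumℚ (q ∷ qs) ℚ.* ((+ 1) ℚ./ suc (length qs))

range : ℕ → List ℕ
range = upTo

subsetsOfSize : ℕ → ℕ → List (List ℕ)
subsetsOfSize zero k = [] ∷ []
subsetsOfSize (suc n) zero = []
subsetsOfSize (suc n) (suc k) = subsetsOfSize (suc n) k ++ map (k ∷_) (subsetsOfSize n k)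

maxload : ℕ → (ℕ → ℕ) → List ℕ → ℕ
maxload n h X = foldr ℕ._⊔_ 0 (map (λ b → length (filter (λ x → h x ≟ b) X)) (range n))

units : ℕ → List ℕ
units k = filter (λ c → gcd c k ≟ 1) (range k)

-- SH_k hash with multiplier c, n bins:  ⌊ 𝔪_k(c x) / (k/n) ⌋ = ⌊ n · (c x mod k) / k ⌋
shBin : ℕ → ℕ → ℕ → ℕ → ℕ
shBin n zero c x = 0
shBin n (suc k) c x = (n ℕ.* ((c ℕ.* x) % suc k)) / suc k

expSH : ℕ → ℕ → List ℕ → ℚ
expSH k n X = avgℚ (map (λ c → ℕtoℚ (maxload n (shBin n k c) X)) (units k))

M-SH : ℕ → ℕ → ℚ
M-SH k n = maxℚ (map (expSH k n) (subsetsOfSize n k))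

halfRange : ℕ → List ℕ
halfRange m = filter (λ k → m ≤? 2 ℕ.* k) (range (suc m))

expRH : ℕ → ℕ → List ℕ → ℚ
expRH m n X = avgℚ (map (λ k → expSH k n X) (halfRange m))

-- real hashing: bin of x for the (nonnegative rational) multiplier a:
--   ⌊ 𝔪_1(a x) / (1/n) ⌋ = ⌊ n a x ⌋ mod n
realBin : ℕ → ℚ → ℕ → ℕ
realBin zero a x = 0
realBin (suc n) a x =
  ((suc n ℕ.* ∣ ↥ a ∣ ℕ.* x) / suc (ℚ.denominator-1 a)) % suc n

-- the points in [0,1] at which some bin ⌊ n a x ⌋ mod n (x ∈ X) can change:
-- a = j/(n x), 0 ≤ j ≤ n x, together with 0 and 1
breakpoints : ℕ → List ℕ → List ℚ
breakpoints zero X = 0ℚ ∷ ℚ.1ℚ ∷ []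
breakpoints (suc n) X = 0ℚ ∷ ℚ.1ℚ ∷ concatMap pts X
  where
  pts : ℕ → List ℚ
  pts zero = []
  pts (suc y) = applyUpTo (λ j → (+ j) ℚ./ (suc n ℕ.* suc y)) (suc (suc n ℕ.* suc y))

-- ∫ over consecutive sorted breakpoints of a piecewise-constant function,
-- evaluated at the midpoint of each interval
pieceSum : (ℚ → ℚ) → List ℚ → ℚ
pieceSum f [] = 0ℚ
pieceSum f (p ∷ []) = 0ℚ
pieceSum f (p ∷ q ∷ ps) =
  (q ℚ.- p) ℚ.* f ((p ℚ.+ q) ℚ.* ℚ.½) ℚ.+ pieceSum f (q ∷ ps)

-- expected maxload of ℝH_u on X, a uniform in (0,1): the maxload is constant
-- on each open interval between consecutive breakpoints, so the expectation
-- (Lebesgue integral over (0,1)) is this exact finite sum.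
expReal : ℕ → List ℕ → ℚ
expReal n X =
  pieceSum (λ a → ℕtoℚ (maxload n (realBin n a) X)) (sort (breakpoints n X))

isqrt : ℕ → ℕ
isqrt m = length (filter (λ s → s ℕ.* s ≤? m) (applyUpTo suc m))

M-RH : ℕ → ℕ → ℚ
M-RH n u = maxℚ (map (expRH (isqrt (n ℕ.* u)) n) (subsetsOfSize n (isqrt (n ℕ.* u))))

M-max : ℕ → ℕ → ℚ
M-max n u = maxℚ (map (λ k → M-SH k n) (filter (λ k → u <? k ℕ.* k) (range (suc (n ℕ.* u)))))

M-ℝ : ℕ → ℕ → ℚ
M-ℝ n u = maxℚ (map (expReal n) (subsetsOfSize n u))

-- log log n (binary logarithms, floored; equivalent up to constants for large n)
loglog : ℕ → ℕ
loglog n = ⌊log₂ ⌊log₂ n ⌋ ⌋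

{-# OPTIONS --safe #-}
module Submission where

-- Real hashing is compared with hashing by fractions c / k.  If a and c / k
-- differ by at most s / (n max X), then ⌊ n a x ⌋ and ⌊ n x c / k ⌋ differ by at
-- most s for all x in X, so each bin of one hash function is covered by 2 s + 1
-- bins of the other, and the maxloads agree up to that factor.
--
-- Upper bound: take k a power of two with k ≤ n u < 2 k.  Its units are the odd
-- numbers, and a uniform real falls next to each c / k with the same probability.
--
-- Lower bound: distinct reduced fractions with denominators at most m are
-- 1 / m ^ 2 apart, so they lie in distinct cells [β / m ^ 2, (β + 1) / m ^ 2).
-- The random modulus picks a given fraction with probability O(1 / (m φ(k))),
-- which exceeds the measure of its cell by a factor O(m / φ(k)) only, and
-- k ≤ O(log log k) φ(k).
--
-- The last bound needs no prime number estimates.  Let Q be the set of primes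
-- dividing k.  Up to a factor 2, k / φ(k) is ∏ (1 + 1 / q) = Σ 1 / d over the
-- products d of subsets of Q.  Since Σ log d / d = O(Σ 1 / d · Σ log q / q), and
-- Σ log q / q = O(log log k) by double counting, half of Σ 1 / d comes from d with
-- log d = O(log log k), and these contribute at most a harmonic sum.
--
-- The expectation over real a equals the average over the midpoints
-- (2 l + 1) / 2 M of a grid fine enough to contain all breakpoints.

open import Defs
open import Data.Nat using (ℕ; _≤_; _^_; _*_)
open import Data.Rational using (ℚ; 0ℚ) renaming (_<_ to _<ℚ_; _≤_ to _≤ℚ_; _*_ to _*ℚ_)
open import Data.Product using (_×_; ∃-syntax)

open import Data.Empty using (⊥-elim)
import Data.Integer as ℤ
open ℤ using () renaming (+_ to pos)
import Data.Integer.Properties as ℤ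
open import Data.List using (List; []; _∷_; _++_; map; filter; length; foldr; concatMap; upTo; downFrom; applyUpTo)
open import Data.List.Membership.Propositional using (_∈_; find; lose)
open import Data.List.Membership.Propositional.Properties using (∈-∃++; ∈-++⁻; ∈-++⁺ˡ; ∈-++⁺ʳ; ∈-map⁺; ∈-map⁻; ∈-filter⁺; ∈-filter⁻; ∈-concatMap⁺; ∈-concatMap⁻; ∈-upTo⁺; ∈-upTo⁻; ∈-downFrom⁺; ∈-downFrom⁻; ∈-applyUpTo⁺; ∈-applyUpTo⁻)
open import Data.List.Properties using (filter-reject; length-downFrom; length-map; map-++; map-∘; upTo-∷ʳ)
open import Data.List.Relation.Binary.Permutation.Propositional using (↭-sym)
open import Data.List.Relation.Binary.Permutation.Propositional.Properties using (∈-resp-↭)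
open import Data.List.Relation.Unary.All as All using (All; []; _∷_)
import Data.List.Relation.Unary.All.Properties as All
open import Data.List.Relation.Unary.AllPairs using ([]; _∷_)
import Data.List.Relation.Unary.AllPairs.Properties as AllPairs
open import Data.List.Relation.Unary.Any using (here; there)
open import Data.List.Relation.Unary.Linked as Linked using (Linked; _∷_)
import Data.List.Relation.Unary.Linked.Properties as Linked
open import Data.List.Relation.Unary.Unique.Propositional using (Unique)
import Data.List.Relation.Unary.Unique.Propositional.Properties as Unique
import Data.List.Sort
open import Data.Nat using (zero; suc; pred; _!; _+_; _∸_; _<_; _<?_; _≤?_; _≟_; _⊔_; z≤n; s≤s; NonZero; >-nonZero; >-nonZero⁻¹; nonTrivial⇒n>1; ⌊_/2⌋; ⌈_/2⌉)
open import Data.Nat.Coprimality as Coprime using (coprime-divisor; gcd≡1⇒coprime)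
open import Data.Nat.DivMod
open import Data.Nat.Divisibility
open import Data.Nat.GCD using (gcd; gcd[m,n]∣m; gcd[m,n]∣n; gcd[m,n]≢0; gcd-greatest)
open import Data.Nat.ListAction using (product)
open import Data.Nat.Logarithm using (⌊log₂_⌋; ⌊log₂⌋-mono-≤; ⌊log₂[2^n]⌋≡n)
open import Data.Nat.Primality
open import Data.Nat.Primality.Factorisation using (factorise; factorisationHasAllPrimeFactors)
open import Data.Nat.Properties hiding (_≟_; _≤?_; _<?_)
open import Data.Nat.Tactic.RingSolver using (solve-∀)
open import Data.Product using (_,_; proj₁; proj₂)
open import Data.Rational as ℚ using (1ℚ; ½; ↥_; ↧ₙ_; toℚᵘ)
import Data.Rational.Properties as ℚ
open import Data.Rational.Solver using (module +-*-Solver)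
open import Data.Rational.Unnormalised as ℚᵘ using (mkℚᵘ; *≡*; *≤*)
import Data.Rational.Unnormalised.Properties as ℚᵘ
open import Data.Sum using (_⊎_; inj₁; inj₂)
open import Function using (_∘_; id)
open import Level using (Level)
open import Relation.Binary.PropositionalEquality
open import Relation.Nullary using (¬_; Dec; yes; no; contradiction; ¬?; _×-dec_)
open import Relation.Unary using (Decidable; Pred)

open Data.List.Sort ℚ.≤-decTotalOrder using (sort; sort-↭; sort-↗)

private variable
  a b p : Level
  A : Set a
  B : Set b

-- Finite sums

∑ : List A → (A → ℕ) → ℕ
∑ []       f = 0
∑ (x ∷ xs) f = f x + ∑ xs f

∑-mono : ∀ (xs : List A) {f g : A → ℕ} → (∀ {x} → x ∈ xs → f x ≤ g x) → ∑ xs f ≤ ∑ xs g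
∑-mono []       h = z≤n
∑-mono (x ∷ xs) h = +-mono-≤ (h (here refl)) (∑-mono xs (h ∘ there))

∑-cong : ∀ (xs : List A) {f g : A → ℕ} → (∀ {x} → x ∈ xs → f x ≡ g x) → ∑ xs f ≡ ∑ xs g
∑-cong []       h = refl
∑-cong (x ∷ xs) h = cong₂ _+_ (h (here refl)) (∑-cong xs (h ∘ there))

∑-++ : ∀ (xs ys : List A) (f : A → ℕ) → ∑ (xs ++ ys) f ≡ ∑ xs f + ∑ ys f
∑-++ []       ys f = refl
∑-++ (x ∷ xs) ys f = trans (cong (f x +_) (∑-++ xs ys f)) (sym (+-assoc (f x) _ _))

∑-map : ∀ (xs : List A) (h : A → B) (f : B → ℕ) → ∑ (map h xs) f ≡ ∑ xs (f ∘ h)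
∑-map []       h f = refl
∑-map (x ∷ xs) h f = cong (f (h x) +_) (∑-map xs h f)

∑-concatMap : ∀ (xs : List A) (h : A → List B) (f : B → ℕ) →
  ∑ (concatMap h xs) f ≡ ∑ xs (λ x → ∑ (h x) f)
∑-concatMap []       h f = refl
∑-concatMap (x ∷ xs) h f =
  trans (∑-++ (h x) (concatMap h xs) f) (cong (∑ (h x) f +_) (∑-concatMap xs h f))

∑-*ˡ : ∀ (xs : List A) c (f : A → ℕ) → ∑ xs (λ x → c * f x) ≡ c * ∑ xs f
∑-*ˡ []       c f = sym (*-zeroʳ c)
∑-*ˡ (x ∷ xs) c f = trans (cong (c * f x +_) (∑-*ˡ xs c f)) (sym (*-distribˡ-+ c (f x) _))

∑-+ : ∀ (xs : List A) (f g : A → ℕ) → ∑ xs (λ x → f x + g x) ≡ ∑ xs f + ∑ xs g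
∑-+ []       f g = refl
∑-+ (x ∷ xs) f g = trans (cong (f x + g x +_) (∑-+ xs f g)) (lem (f x) (g x) (∑ xs f) (∑ xs g))
  where
  lem : ∀ a b c d → a + b + (c + d) ≡ a + c + (b + d)
  lem = solve-∀

∑-const : ∀ (xs : List A) c → ∑ xs (λ _ → c) ≡ length xs * c
∑-const []       c = refl
∑-const (x ∷ xs) c = cong (c +_) (∑-const xs c)

∑-swap : ∀ (xs : List A) (ys : List B) (f : A → B → ℕ) →
  ∑ xs (λ x → ∑ ys (f x)) ≡ ∑ ys (λ y → ∑ xs (λ x → f x y))
∑-swap []       ys f = sym (trans (∑-const ys 0) (*-zeroʳ (length ys)))
∑-swap (x ∷ xs) ys f =
  trans (cong (∑ ys (f x) +_) (∑-swap xs ys f)) (sym (∑-+ ys (f x) _))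

-- The definitions of the statement enumerate upwards with `upTo`, whereas `downFrom (suc n)`
-- exposes its new element by computation and so suits induction on `n`.
∑-upTo : ∀ n (f : ℕ → ℕ) → ∑ (upTo n) f ≡ ∑ (downFrom n) f
∑-upTo zero    f = refl
∑-upTo (suc n) f = begin
  ∑ (upTo (suc n)) f          ≡⟨ cong (λ l → ∑ l f) (upTo-∷ʳ n) ⟨
  ∑ (upTo n ++ n ∷ []) f      ≡⟨ ∑-++ (upTo n) (n ∷ []) f ⟩
  ∑ (upTo n) f + (f n + 0)    ≡⟨ cong₂ _+_ (∑-upTo n f) (+-identityʳ (f n)) ⟩
  ∑ (downFrom n) f + f n      ≡⟨ +-comm _ (f n) ⟩
  f n + ∑ (downFrom n) f      ∎
  where open ≡-Reasoning

∑-downFrom-+ : ∀ m n (f : ℕ → ℕ) →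
  ∑ (downFrom (m + n)) f ≡ ∑ (downFrom m) f + ∑ (downFrom n) (λ i → f (m + i))
∑-downFrom-+ m zero    f rewrite +-identityʳ m = sym (+-identityʳ _)
∑-downFrom-+ m (suc n) f rewrite +-suc m n =
  trans (cong (f (m + n) +_) (∑-downFrom-+ m n f)) (lem (f (m + n)) (∑ (downFrom m) f) (∑ (downFrom n) (λ i → f (m + i))))
  where
  lem : ∀ a b c → a + (b + c) ≡ b + (a + c)
  lem = solve-∀

-- Cutting into `m` blocks of length `w` serves twice: the sieve takes blocks between consecutive
-- multiples of a prime, and the integral takes blocks of grid points in a common cell.
∑-downFrom-* : ∀ m w (f : ℕ → ℕ) →
  ∑ (downFrom (m * w)) f ≡ ∑ (downFrom m) (λ i → ∑ (downFrom w) (λ j → f (i * w + j)))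
∑-downFrom-* zero    w f = refl
∑-downFrom-* (suc m) w f = begin
  ∑ (downFrom (w + m * w)) f
    ≡⟨ cong (λ l → ∑ (downFrom l) f) (+-comm w (m * w)) ⟩
  ∑ (downFrom (m * w + w)) f                                  ≡⟨ ∑-downFrom-+ (m * w) w f ⟩
  ∑ (downFrom (m * w)) f + ∑ (downFrom w) (λ j → f (m * w + j)) ≡⟨ +-comm (∑ (downFrom (m * w)) f) _ ⟩
  ∑ (downFrom w) (λ j → f (m * w + j)) + ∑ (downFrom (m * w)) f
    ≡⟨ cong (∑ (downFrom w) (λ j → f (m * w + j)) +_) (∑-downFrom-* m w f) ⟩
  ∑ (downFrom (suc m)) (λ i → ∑ (downFrom w) (λ j → f (i * w + j))) ∎
  where open ≡-Reasoning

-- Each element of `xs` is matched with one occurrence in `ys`, which is then removed; distinctness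
-- keeps the remaining elements of `xs` in what is left. This carries all the counting arguments
-- below.
∑-unique-⊆ : ∀ {xs ys : List A} (f : A → ℕ) → Unique xs → (∀ {x} → x ∈ xs → x ∈ ys) → ∑ xs f ≤ ∑ ys f
∑-unique-⊆ {xs = []}     f uniq       sub = z≤n
∑-unique-⊆ {xs = x ∷ xs} f (x∉ ∷ uniq) sub with ∈-∃++ (sub (here refl))
... | as , bs , refl = begin
  f x + ∑ xs f               ≤⟨ +-monoʳ-≤ (f x) (∑-unique-⊆ f uniq sub′) ⟩
  f x + ∑ (as ++ bs) f       ≡⟨ cong (f x +_) (∑-++ as bs f) ⟩
  f x + (∑ as f + ∑ bs f)    ≡⟨ lem (f x) (∑ as f) (∑ bs f) ⟩
  ∑ as f + (f x + ∑ bs f)    ≡⟨ ∑-++ as (x ∷ bs) f ⟨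
  ∑ (as ++ x ∷ bs) f         ∎
  where
  open ≤-Reasoning
  lem : ∀ a b c → a + (b + c) ≡ b + (a + c)
  lem = solve-∀
  sub′ : ∀ {y} → y ∈ xs → y ∈ as ++ bs
  sub′ y∈ with ∈-++⁻ as (sub (there y∈))
  ... | inj₁ y∈as          = ∈-++⁺ˡ y∈as
  ... | inj₂ (here refl)   = ⊥-elim (All.lookup x∉ y∈ refl)
  ... | inj₂ (there y∈bs)  = ∈-++⁺ʳ as y∈bs

𝟙 : Dec A → ℕ
𝟙 (yes _) = 1
𝟙 (no _)  = 0

∑-𝟙 : ∀ {P : Pred A p} (P? : Decidable P) xs (f : A → ℕ) →
  ∑ xs (λ x → f x * 𝟙 (P? x)) ≡ ∑ (filter P? xs) f
∑-𝟙 P? []       f = refl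
∑-𝟙 P? (x ∷ xs) f with P? x
... | yes _ = cong₂ _+_ (*-identityʳ (f x)) (∑-𝟙 P? xs f)
... | no  _ = trans (cong (_+ ∑ xs (λ y → f y * 𝟙 (P? y))) (*-zeroʳ (f x))) (∑-𝟙 P? xs f)

-- Products of distinct primes

prime∤product : ∀ {q qs} → Prime q → All Prime qs → All (q ≢_) qs → q ∤ product qs
prime∤product q-prime primes q∉qs q∣ =
  All.lookup q∉qs (factorisationHasAllPrimeFactors q-prime q∣ primes) refl

-- With `j = r * product qs`, the new prime divides `r` or the product, and the latter would make it
-- one of the old primes.
primes-product-∣ : ∀ {qs j} → All Prime qs → Unique qs → All (_∣ j) qs → product qs ∣ j
primes-product-∣ {[]}     {j} _ _ _ = 1∣ j
primes-product-∣ {q ∷ qs} {j} (q-prime ∷ primes) (q∉qs ∷ uniq) (q∣j ∷ qs∣j)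
  with primes-product-∣ primes uniq qs∣j
... | divides r refl with euclidsLemma r (product qs) q-prime q∣j
... | inj₁ q∣r = *-monoˡ-∣ (product qs) q∣r
... | inj₂ q∣P = ⊥-elim (prime∤product q-prime primes q∉qs q∣P)

-- The sieve of Legendre

-- The indicator that no member of `qs` divides `c`, written as a product so that adding a prime
-- multiplies by one factor.
sifted : List ℕ → ℕ → ℕ
sifted []       c = 1
sifted (q ∷ qs) c = 𝟙 (¬? (q ∣? c)) * sifted qs c

sifted≤1 : ∀ qs c → sifted qs c ≤ 1
sifted≤1 []       c = ≤-refl
sifted≤1 (q ∷ qs) c with q ∣? c
... | yes _ = z≤n
... | no  _ = ≤-trans (≤-reflexive (+-identityʳ _)) (sifted≤1 qs c)

sifted-∣ : ∀ {q qs c} → q ∈ qs → q ∣ c → sifted qs c ≡ 0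
sifted-∣ {q} {.q ∷ qs} {c} (here refl) q∣c with q ∣? c
... | yes _  = refl
... | no q∤c = contradiction q∣c q∤c
sifted-∣ {q} {r ∷ qs} {c} (there q∈) q∣c =
  trans (cong (𝟙 (¬? (r ∣? c)) *_) (sifted-∣ q∈ q∣c)) (*-zeroʳ (𝟙 (¬? (r ∣? c))))

sifted-*-prime : ∀ {q qs} c → Prime q → All Prime qs → All (q ≢_) qs →
  sifted qs (c * q) ≡ sifted qs c
sifted-*-prime {q} {[]}     c _ _ _ = refl
sifted-*-prime {q} {r ∷ qs} c q-prime (r-prime ∷ primes) (q≢r ∷ q∉qs)
  with r ∣? c * q | r ∣? c
... | yes _   | yes _  = refl
... | no _    | no _   = cong (1 *_) (sifted-*-prime c q-prime primes q∉qs)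
... | no r∤cq | yes r∣c = contradiction (∣m⇒∣m*n q r∣c) r∤cq
... | yes r∣cq | no r∤c with euclidsLemma c q r-prime r∣cq
...   | inj₁ r∣c = contradiction r∣c r∤c
...   | inj₂ r∣q with prime⇒irreducible q-prime r∣q
...     | inj₁ refl = contradiction r-prime ¬prime[1]
...     | inj₂ refl = contradiction refl q≢r

-- In the block from `i * q` to `i * q + q - 1` only the first term survives.
∑-multiples : ∀ N q .{{_ : NonZero q}} (g : ℕ → ℕ) →
  ∑ (downFrom (N * q)) (λ c → 𝟙 (q ∣? c) * g c) ≡ ∑ (downFrom N) (λ c → g (c * q))
∑-multiples N q@(suc r) g =
  trans (∑-downFrom-* N q (λ c → 𝟙 (q ∣? c) * g c)) (∑-cong (downFrom N) (λ {i} _ → block i))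
  where
  open ≡-Reasoning
  first : ∀ i → 𝟙 (q ∣? (i * q + 0)) * g (i * q + 0) ≡ g (i * q)
  first i rewrite +-identityʳ (i * q) with q ∣? i * q
  ... | yes _ = +-identityʳ (g (i * q))
  ... | no q∤ = contradiction (n∣m*n i) q∤
  rest : ∀ i {j} → j ∈ downFrom r → 𝟙 (q ∣? (i * q + suc j)) * g (i * q + suc j) ≡ 0
  rest i {j} j∈ with q ∣? (i * q + suc j)
  ... | no _  = refl
  ... | yes q∣ = contradiction (∣m+n∣m⇒∣n q∣ (n∣m*n i)) (>⇒∤ (s≤s (∈-downFrom⁻ j∈)))
  block : ∀ i → ∑ (downFrom q) (λ j → 𝟙 (q ∣? (i * q + j)) * g (i * q + j)) ≡ g (i * q)
  block i = begin
    ∑ (downFrom q) F                                             ≡⟨ ∑-downFrom-+ 1 r F ⟩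
    F 0 + 0 + ∑ (downFrom r) (λ j → F (1 + j))
      ≡⟨ cong₂ _+_ (trans (+-identityʳ (F 0)) (first i)) (trans (∑-cong (downFrom r) (rest i)) (trans (∑-const (downFrom r) 0) (*-zeroʳ (length (downFrom r))))) ⟩
    g (i * q) + 0                                                ≡⟨ +-identityʳ (g (i * q)) ⟩
    g (i * q)                                                    ∎
    where
    F : ℕ → ℕ
    F j = 𝟙 (q ∣? (i * q + j)) * g (i * q + j)

∑-sifted-∷ : ∀ q qs (xs : List ℕ) →
  ∑ xs (sifted (q ∷ qs)) + ∑ xs (λ c → 𝟙 (q ∣? c) * sifted qs c) ≡ ∑ xs (sifted qs)
∑-sifted-∷ q qs xs = trans (sym (∑-+ xs _ _)) (∑-cong xs (λ {c} _ → step c))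
  where
  step : ∀ c → sifted (q ∷ qs) c + 𝟙 (q ∣? c) * sifted qs c ≡ sifted qs c
  step c with q ∣? c
  ... | yes _ = +-identityʳ _
  ... | no  _ = trans (+-identityʳ _) (+-identityʳ _)

-- This is the count `N ∏ (1 - 1 / q)` with denominators cleared; divisibility of `N` by all the
-- primes makes it exact. In the induction, what survives `qs` either survives `q` too or is a
-- multiple `c * q`, and the latter survives exactly when `c` does, so these are counted by the same
-- formula at `N / q`.
legendre : ∀ {qs} N → All Prime qs → Unique qs → product qs ∣ N →
  ∑ (downFrom N) (sifted qs) * product qs ≡ N * product (map pred qs)
legendre {[]} N _ _ _ = cong (_* 1) (trans (∑-const (downFrom N) 1) (trans (*-identityʳ _) (length-downFrom N)))
legendre {zero ∷ qs} N (q-prime ∷ _) _ _ = contradiction q-prime ¬prime[0]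
legendre {q@(suc r) ∷ qs} .(t * (q * product qs)) (q-prime ∷ primes) (q∉qs ∷ uniq) (divides t refl) = begin
  sN * (q * P)          ≡⟨ lem₁ sN q P ⟩
  -- The count of the multiples of `q` is added to both sides and cancelled, in place of a
  -- subtraction in ℕ.
  q * (sN * P)          ≡⟨ cong (q *_) (+-cancelʳ-≡ (N′ * Π′) (sN * P) (N′ * (r * Π′)) count) ⟩
  q * (N′ * (r * Π′))   ≡⟨ lem₂ q t P (r * Π′) ⟩
  t * (q * P) * (r * Π′) ∎
  where
  open ≡-Reasoning
  P  = product qs
  Π′ = product (map pred qs)
  N  = t * (q * P)
  N′ = t * P
  sN = ∑ (downFrom N) (sifted (q ∷ qs))
  lem₁ : ∀ a b c → a * (b * c) ≡ b * (a * c)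
  lem₁ = solve-∀
  lem₂ : ∀ q t P c → q * (t * P * c) ≡ t * (q * P) * c
  lem₂ = solve-∀
  lem₃ : ∀ r t P → t * (suc r * P) ≡ t * P * suc r
  lem₃ = solve-∀
  lem₄ : ∀ r t P c → t * (suc r * P) * c ≡ t * P * (r * c) + t * P * c
  lem₄ = solve-∀
  multiples : ∑ (downFrom N) (λ c → 𝟙 (q ∣? c) * sifted qs c) ≡ ∑ (downFrom N′) (sifted qs)
  multiples = begin
    ∑ (downFrom N) (λ c → 𝟙 (q ∣? c) * sifted qs c)
      ≡⟨ cong (λ l → ∑ (downFrom l) (λ c → 𝟙 (q ∣? c) * sifted qs c)) (lem₃ r t P) ⟩
    ∑ (downFrom (N′ * q)) (λ c → 𝟙 (q ∣? c) * sifted qs c) ≡⟨ ∑-multiples N′ q (sifted qs) ⟩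
    ∑ (downFrom N′) (λ c → sifted qs (c * q))
      ≡⟨ ∑-cong (downFrom N′) (λ {c} _ → sifted-*-prime c q-prime primes q∉qs) ⟩
    ∑ (downFrom N′) (sifted qs)                            ∎
  count : sN * P + N′ * Π′ ≡ N′ * (r * Π′) + N′ * Π′
  count = begin
    sN * P + N′ * Π′
      ≡⟨ cong (sN * P +_) (legendre N′ primes uniq (n∣m*n t)) ⟨
    sN * P + ∑ (downFrom N′) (sifted qs) * P             ≡⟨ *-distribʳ-+ P sN _ ⟨
    (sN + ∑ (downFrom N′) (sifted qs)) * P               ≡⟨ cong (λ l → (sN + l) * P) multiples ⟨
    (sN + ∑ (downFrom N) (λ c → 𝟙 (q ∣? c) * sifted qs c)) * P ≡⟨ cong (_* P) (∑-sifted-∷ q qs (downFrom N)) ⟩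
    ∑ (downFrom N) (sifted qs) * P                       ≡⟨ legendre N primes uniq (∣n⇒∣m*n t (n∣m*n q)) ⟩
    N * Π′                                               ≡⟨ lem₄ r t P Π′ ⟩
    N′ * (r * Π′) + N′ * Π′                              ∎

-- Prime divisors of an integer and its totient

primeDivisor? : ∀ k → Decidable (λ q → Prime q × q ∣ k)
primeDivisor? k q = prime? q ×-dec q ∣? k

primesOf : ℕ → List ℕ
primesOf k = filter (primeDivisor? k) (downFrom (suc k))

primesOf-prime : ∀ k → All Prime (primesOf k)
primesOf-prime k = All.map proj₁ (All.all-filter (primeDivisor? k) (downFrom (suc k)))

primesOf-∣ : ∀ k → All (_∣ k) (primesOf k)
primesOf-∣ k = All.map proj₂ (All.all-filter (primeDivisor? k) (downFrom (suc k)))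

primesOf-unique : ∀ k → Unique (primesOf k)
primesOf-unique k = Unique.filter⁺ (primeDivisor? k) (Unique.downFrom⁺ (suc k))

product-primesOf-∣ : ∀ k → product (primesOf k) ∣ k
product-primesOf-∣ k = primes-product-∣ (primesOf-prime k) (primesOf-unique k) (primesOf-∣ k)

∃-prime-divisor : ∀ n → n ≢ 0 → n ≢ 1 → ∃[ q ] Prime q × q ∣ n
∃-prime-divisor zero n≢0 _ = contradiction refl n≢0
∃-prime-divisor n@(suc _) _ n≢1 with factorise n
... | record { factors = []     ; isFactorisation = eq } = contradiction eq n≢1
... | record { factors = q ∷ qs ; isFactorisation = eq ; factorsPrime = q-prime ∷ _ } =
  q , q-prime , subst (q ∣_) (sym eq) (m∣m*n (product qs))

-- If `gcd c k` is not 1, it has a prime divisor, which belongs to `primesOf k` and sifts `c` out.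
∑-sifted≤units : ∀ k .{{_ : NonZero k}} → ∑ (downFrom k) (sifted (primesOf k)) ≤ length (units k)
∑-sifted≤units k@(suc _) = begin
  ∑ (downFrom k) (sifted ps)               ≤⟨ ∑-mono (downFrom k) (λ {c} _ → coprime c) ⟩
  ∑ (downFrom k) (λ c → 1 * 𝟙 (gcd c k ≟ 1)) ≡⟨ ∑-upTo k _ ⟨
  ∑ (upTo k) (λ c → 1 * 𝟙 (gcd c k ≟ 1))   ≡⟨ ∑-𝟙 (λ c → gcd c k ≟ 1) (upTo k) (λ _ → 1) ⟩
  ∑ (units k) (λ _ → 1)                    ≡⟨ ∑-const (units k) 1 ⟩
  length (units k) * 1                     ≡⟨ *-identityʳ _ ⟩
  length (units k)                         ∎
  where
  open ≤-Reasoning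
  ps = primesOf k
  coprime : ∀ c → sifted ps c ≤ 1 * 𝟙 (gcd c k ≟ 1)
  coprime c with gcd c k ≟ 1
  ... | yes _ = sifted≤1 ps c
  ... | no g≢1 with ∃-prime-divisor (gcd c k) (gcd[m,n]≢0 c k (inj₂ λ ())) g≢1
  ...   | q , q-prime , q∣g = ≤-reflexive (sifted-∣ q∈ (∣-trans q∣g (gcd[m,n]∣m c k)))
    where
    q∣k : q ∣ k
    q∣k = ∣-trans q∣g (gcd[m,n]∣n c k)
    q∈ : q ∈ ps
    q∈ = ∈-filter⁺ (primeDivisor? k) (∈-downFrom⁺ (s≤s (∣⇒≤ q∣k))) (q-prime , q∣k)

units-lower : ∀ k .{{_ : NonZero k}} →
  k * product (map pred (primesOf k)) ≤ length (units k) * product (primesOf k)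
units-lower k = ≤-trans
  (≤-reflexive (sym (legendre k (primesOf-prime k) (primesOf-unique k) (product-primesOf-∣ k))))
  (*-monoˡ-≤ (product (primesOf k)) (∑-sifted≤units k))

-- Over all integers `j` from 2 to `suc m` the product `∏ (1 - 1 / j²)` telescopes to
-- `(2 + m) / (2 * suc m)`. Restricting to the `j` that satisfy `P` drops factors below 1, so the
-- product only grows.
∏-telescope : ∀ {P : Pred ℕ p} (P? : Decidable P) → ¬ P 0 → ¬ P 1 → ∀ m →
  let qs = filter P? (downFrom (2 + m)) in
  (2 + m) * (product qs * product qs) ≤ 2 * suc m * (product (map pred qs) * product (map suc qs))
∏-telescope P? ¬P0 ¬P1 zero
  rewrite filter-reject P? {x = 1} {xs = 0 ∷ []} ¬P1 | filter-reject P? {x = 0} {xs = []} ¬P0 = ≤-refl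
∏-telescope P? ¬P0 ¬P1 (suc m) with P? (2 + m) | ∏-telescope P? ¬P0 ¬P1 m
... | yes _ | ih = begin
  (3 + m) * (q * Q * (q * Q))                    ≡⟨ lem₁ m Q ⟩
  (3 + m) * q * (q * (Q * Q))                    ≤⟨ *-monoʳ-≤ ((3 + m) * q) ih ⟩
  (3 + m) * q * (2 * suc m * (Q⁻ * Q⁺))          ≡⟨ lem₂ m Q⁻ Q⁺ ⟩
  2 * (2 + m) * (suc m * Q⁻ * ((3 + m) * Q⁺))    ∎
  where
  open ≤-Reasoning
  q  = 2 + m
  qs = filter P? (downFrom (2 + m))
  Q  = product qs
  Q⁻ = product (map pred qs)
  Q⁺ = product (map suc qs)
  lem₁ : ∀ m P → (3 + m) * ((2 + m) * P * ((2 + m) * P)) ≡ (3 + m) * (2 + m) * ((2 + m) * (P * P))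
  lem₁ = solve-∀
  lem₂ : ∀ m a b → (3 + m) * (2 + m) * (2 * suc m * (a * b)) ≡ 2 * (2 + m) * (suc m * a * ((3 + m) * b))
  lem₂ = solve-∀
... | no _ | ih = *-cancelˡ-≤ (2 + m) (begin
  (2 + m) * ((3 + m) * Q)             ≡⟨ lem₁ m Q ⟩
  (3 + m) * ((2 + m) * Q)             ≤⟨ *-monoʳ-≤ (3 + m) ih ⟩
  -- The omitted factor costs exactly `2 * Q′`, because `(2 + m)² = (1 + m) (3 + m) + 1`.
  (3 + m) * (2 * suc m * Q′)          ≤⟨ m≤m+n _ (2 * Q′) ⟩
  (3 + m) * (2 * suc m * Q′) + 2 * Q′ ≡⟨ lem₂ m Q′ ⟩
  (2 + m) * (2 * (2 + m) * Q′)        ∎)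
  where
  open ≤-Reasoning
  qs = filter P? (downFrom (2 + m))
  Q  = product qs * product qs
  Q′ = product (map pred qs) * product (map suc qs)
  lem₁ : ∀ m Q → (2 + m) * ((3 + m) * Q) ≡ (3 + m) * ((2 + m) * Q)
  lem₁ = solve-∀
  lem₂ : ∀ m Q → (3 + m) * (2 * suc m * Q) + 2 * Q ≡ (2 + m) * (2 * (2 + m) * Q)
  lem₂ = solve-∀

-- Since `∏ (1 - 1 / q²)` is at least 1/2, `∏ q / (q - 1)` is at most `2 ∏ (1 + 1 / q)`. The second
-- product has a finite expansion over squarefree divisors.
primesOf-square : ∀ k .{{_ : NonZero k}} → let qs = primesOf k in
  product qs * product qs ≤ 2 * (product (map pred qs) * product (map suc qs))
primesOf-square k@(suc m) = *-cancelˡ-≤ (suc k) (begin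
  suc k * Q          ≤⟨ ∏-telescope (primeDivisor? k) (¬prime[0] ∘ proj₁) (¬prime[1] ∘ proj₁) m ⟩
  2 * k * Q′         ≤⟨ *-monoˡ-≤ Q′ (*-monoʳ-≤ 2 (n≤1+n k)) ⟩
  2 * suc k * Q′     ≡⟨ lem (suc k) Q′ ⟩
  suc k * (2 * Q′)   ∎)
  where
  open ≤-Reasoning
  qs = primesOf k
  Q  = product qs * product qs
  Q′ = product (map pred qs) * product (map suc qs)
  lem : ∀ a b → 2 * a * b ≡ a * (2 * b)
  lem = solve-∀

-- Binary logarithms

2^-cancel-≤ : ∀ {m n} → 2 ^ m ≤ 2 ^ n → m ≤ n
2^-cancel-≤ {m} {n} le = ≮⇒≥ λ n<m → <⇒≱ (^-monoʳ-< 2 (s≤s (s≤s z≤n)) n<m) le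

dyadic : ∀ n → ∃[ e ] (2 ^ e ≤ suc n × suc n < 2 ^ suc e)
dyadic zero = 0 , s≤s z≤n , s≤s (s≤s z≤n)
dyadic (suc n) with dyadic n
... | e , lower , upper with suc (suc n) <? 2 ^ suc e
...   | yes lt = e , m≤n⇒m≤1+n lower , lt
...   | no ≥   = suc e , ≮⇒≥ ≥ , ≤-<-trans upper (m<m+n (2 ^ suc e) (≤-trans (m^n>0 2 (suc e)) (m≤m+n (2 ^ suc e) 0)))

-- The floor of the binary logarithm for positive `n`, with value 0 at 0; `dyadic` speaks of
-- `suc n`, hence the `pred`.
lg : ℕ → ℕ
lg n = proj₁ (dyadic (pred n))

2^lg≤ : ∀ n .{{_ : NonZero n}} → 2 ^ lg n ≤ n
2^lg≤ (suc n) = proj₁ (proj₂ (dyadic n))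

<2^[1+lg] : ∀ n → n < 2 ^ suc (lg n)
<2^[1+lg] zero    = m^n>0 2 (suc (lg zero))
<2^[1+lg] (suc n) = proj₂ (proj₂ (dyadic n))

-- Rounding the logarithm down loses a factor below 2, and `lg n ≥ 1` lets base 4 make up for it.
≤4^lg : ∀ n → 2 ≤ n → n ≤ 4 ^ lg n
≤4^lg n 2≤n with lg n | <2^[1+lg] n
... | zero  | lt = contradiction lt (≤⇒≯ 2≤n)
... | suc l | lt = begin
  n               ≤⟨ <⇒≤ lt ⟩
  2 ^ (2 + l)     ≤⟨ ^-monoʳ-≤ 2 (≤-trans (≤-reflexive (lem₁ l)) (m≤m+n (1 + l + 1) l)) ⟩
  2 ^ (1 + l + 1 + l) ≡⟨ cong (2 ^_) (lem₂ l) ⟩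
  2 ^ (2 * (1 + l))   ≡⟨ ^-*-assoc 2 2 (suc l) ⟨
  4 ^ (1 + l)     ∎
  where
  open ≤-Reasoning
  lem₁ : ∀ l → 2 + l ≡ 1 + l + 1
  lem₁ = solve-∀
  lem₂ : ∀ l → 1 + l + 1 + l ≡ 2 * (1 + l)
  lem₂ = solve-∀

n<2^[1+⌊log₂n⌋] : ∀ n → n < 2 ^ suc ⌊log₂ n ⌋
n<2^[1+⌊log₂n⌋] n = ≰⇒> λ le → 1+n≰n (begin
  suc ⌊log₂ n ⌋               ≡⟨ ⌊log₂[2^n]⌋≡n (suc ⌊log₂ n ⌋) ⟨
  ⌊log₂ 2 ^ suc ⌊log₂ n ⌋ ⌋   ≤⟨ ⌊log₂⌋-mono-≤ le ⟩
  ⌊log₂ n ⌋                   ∎)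
  where
  open ≤-Reasoning

2^∑lg≤product : ∀ {qs} → All Prime qs → 2 ^ ∑ qs lg ≤ product qs
2^∑lg≤product {[]} [] = ≤-refl
2^∑lg≤product {q ∷ qs} (q-prime ∷ primes) = begin
  2 ^ (lg q + ∑ qs lg)      ≡⟨ ^-distribˡ-+-* 2 (lg q) (∑ qs lg) ⟩
  2 ^ lg q * 2 ^ ∑ qs lg    ≤⟨ *-mono-≤ (2^lg≤ q {{prime⇒nonZero q-prime}}) (2^∑lg≤product primes) ⟩
  q * product qs            ∎
  where open ≤-Reasoning

-- The product of distinct primes dividing `j` is at most `j`. This is used for the modulus itself,
-- with a bound of the form `2 ^ (2 ^ l)`, and for every integer up to `2 ^ l` in `mertens`.
∑lg-prime-divisors : ∀ {qs j l} .{{_ : NonZero j}} → All Prime qs → Unique qs → All (_∣ j) qs → j ≤ 2 ^ l → ∑ qs lg ≤ l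
∑lg-prime-divisors primes uniq qs∣j j≤ = 2^-cancel-≤
  (≤-trans (2^∑lg≤product primes) (≤-trans (∣⇒≤ (primes-product-∣ primes uniq qs∣j)) j≤))

-- Σ log q / q over the primes dividing an integer

-- The quotient `⌊ y / q ⌋` written as a count over `j ≤ y`, which makes the exchange of sums
-- possible.
multiplesUpTo : ℕ → ℕ → ℕ
multiplesUpTo y q = ∑ (downFrom y) (λ j → 𝟙 (q ∣? suc j))

<[1+multiples]* : ∀ y q .{{_ : NonZero q}} → y < suc (multiplesUpTo y q) * q
<[1+multiples]* zero    q = ≤-trans (>-nonZero⁻¹ q) (m≤m+n q 0)
<[1+multiples]* (suc y) q with q ∣? suc y | <[1+multiples]* y q
... | yes _ | ih = +-mono-≤ (>-nonZero⁻¹ q) ih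
-- The only way for the old bound to fail at `suc y` is equality, and then `suc y` would be a
-- multiple of `q`.
... | no q∤ | ih = ≤∧≢⇒< ih λ eq → q∤ (subst (q ∣_) (sym eq) (n∣m*n (suc (multiplesUpTo y q))))

-- Exchanging sums turns Σ_q lg q ⌊ y / q ⌋ into Σ_{j ≤ y} Σ_{q ∣ j} lg q ≤ Σ_{j ≤ y} log j.
mertens : ∀ {qs} l → All Prime qs → Unique qs → ∑ qs lg ≤ 2 ^ l →
  ∑ qs (λ q → lg q * suc (multiplesUpTo (2 ^ l) q)) ≤ 2 ^ l * suc l
mertens {qs} l primes uniq ∑lg≤ = begin
  ∑ qs (λ q → lg q * suc (multiplesUpTo y q))
    ≡⟨ ∑-cong qs (λ {q} _ → *-suc (lg q) (multiplesUpTo y q)) ⟩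
  ∑ qs (λ q → lg q + lg q * multiplesUpTo y q)
    ≡⟨ ∑-+ qs lg (λ q → lg q * multiplesUpTo y q) ⟩
  ∑ qs lg + ∑ qs (λ q → lg q * multiplesUpTo y q)
    -- The 1 added to each `⌊ y / q ⌋` costs `∑ qs lg` in total, which is at most `2 ^ l = y` by
    -- hypothesis.
    ≤⟨ +-mono-≤ ∑lg≤ (≤-reflexive (∑-cong qs (λ {q} _ → sym (∑-*ˡ (downFrom y) (lg q) _)))) ⟩
  y + ∑ qs (λ q → ∑ (downFrom y) (λ j → lg q * 𝟙 (q ∣? suc j)))
    ≡⟨ cong (y +_) (∑-swap qs (downFrom y) (λ q j → lg q * 𝟙 (q ∣? suc j))) ⟩
  y + ∑ (downFrom y) (λ j → ∑ qs (λ q → lg q * 𝟙 (q ∣? suc j)))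
    ≤⟨ +-monoʳ-≤ y (∑-mono (downFrom y) (λ j∈ → divisors (∈-downFrom⁻ j∈))) ⟩
  y + ∑ (downFrom y) (λ _ → l)
    ≡⟨ cong (y +_) (trans (∑-const (downFrom y) l) (cong (_* l) (length-downFrom y))) ⟩
  y + y * l                                                            ≡⟨ *-suc y l ⟨
  y * suc l                                                            ∎
  where
  open ≤-Reasoning
  y = 2 ^ l
  divisors : ∀ {j} → j < y → ∑ qs (λ q → lg q * 𝟙 (q ∣? suc j)) ≤ l
  divisors {j} j<y = ≤-trans (≤-reflexive (∑-𝟙 (_∣? suc j) qs lg))
    (∑lg-prime-divisors {j = suc j} (All.filter⁺ (_∣? suc j) primes) (Unique.filter⁺ (_∣? suc j) uniq)
      (All.all-filter (_∣? suc j) qs) j<y)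

-- The splittings of q₁ … qᵣ are its factorizations d · e with d a product of some
-- of the qᵢ; the weight stands for log d, and Σ e / (q₁ … qᵣ) = Σ 1 / d.
record Splitting : Set where
  constructor splitting
  field divisor codivisor weight : ℕ

open Splitting

without with′ : ℕ → Splitting → Splitting
without q (splitting d e g) = splitting d (q * e) g
with′   q (splitting d e g) = splitting (q * d) e (lg q + g)

splittings : List ℕ → List Splitting
splittings []       = splitting 1 1 0 ∷ []
splittings (q ∷ qs) = map (without q) (splittings qs) ++ map (with′ q) (splittings qs)

-- Induction along the construction of splittings. The property also sees the list of primes, since
-- an invariant such as `divisor*codivisor` refers to its product.
splittings-All : ∀ {ℓ} {P : List ℕ → Splitting → Set ℓ} → P [] (splitting 1 1 0) →
  (∀ {q qs s} → Prime q → P qs s → P (q ∷ qs) (without q s) × P (q ∷ qs) (with′ q s)) →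
  ∀ {qs} → All Prime qs → All (P qs) (splittings qs)
splittings-All         base step {[]}     []                 = base ∷ []
splittings-All {P = P} base step {q ∷ qs} (q-prime ∷ primes) =
  All.++⁺ (All.map⁺ (All.map (proj₁ ∘ step {qs = qs} q-prime) ih)) (All.map⁺ (All.map (proj₂ ∘ step {qs = qs} q-prime) ih))
  where ih = splittings-All {P = P} base step primes

divisor*codivisor : ∀ {qs} → All Prime qs → All (λ s → divisor s * codivisor s ≡ product qs) (splittings qs)
divisor*codivisor = splittings-All {P = λ qs s → divisor s * codivisor s ≡ product qs} refl λ {q} {_} {s} _ eq →
  trans (lem₁ (divisor s) q (codivisor s)) (cong (q *_) eq) ,
  trans (*-assoc q (divisor s) (codivisor s)) (cong (q *_) eq)
  where
  lem₁ : ∀ d q e → d * (q * e) ≡ q * (d * e)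
  lem₁ = solve-∀

divisor≤4^weight : ∀ {qs} → All Prime qs → All (λ s → divisor s ≤ 4 ^ weight s) (splittings qs)
divisor≤4^weight = splittings-All {P = λ _ s → divisor s ≤ 4 ^ weight s} ≤-refl λ {q} {_} {s} q-prime le →
  le , ≤-trans (*-mono-≤ (≤4^lg q (nonTrivial⇒n>1 q {{prime⇒nonTrivial q-prime}})) le)
               (≤-reflexive (sym (^-distribˡ-+-* 4 (lg q) (weight s))))

-- Divisors that take `q` are multiples of `q`; those that do not take it divide `product qs`, which
-- `q` does not.
divisors-unique : ∀ {qs} → All Prime qs → Unique qs → Unique (map divisor (splittings qs))
divisors-unique {[]} _ _ = [] ∷ []
divisors-unique {q ∷ qs} (q-prime ∷ primes) (q∉qs ∷ uniq)
  rewrite map-++ divisor (map (without q) (splittings qs)) (map (with′ q) (splittings qs))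
        | sym (map-∘ {g = divisor} {f = without q} (splittings qs))
        | sym (map-∘ {g = divisor} {f = with′ q} (splittings qs))
        | map-∘ {g = q *_} {f = divisor} (splittings qs)
  = Unique.++⁺ ih (Unique.map⁺ (λ {x} {y} → *-cancelˡ-≡ x y q {{prime⇒nonZero q-prime}}) ih) disjoint
  where
  ih = divisors-unique primes uniq
  disjoint : ∀ {d} → ¬ (d ∈ map divisor (splittings qs) × d ∈ map (q *_) (map divisor (splittings qs)))
  disjoint (d∈ , d∈′) with ∈-map⁻ divisor d∈ | ∈-map⁻ (q *_) d∈′
  ... | s , s∈ , refl | d′ , _ , eq = prime∤product q-prime primes q∉qs
    (subst (q ∣_) (All.lookup (divisor*codivisor primes) s∈)
      (∣m⇒∣m*n (codivisor s) (subst (q ∣_) (sym eq) (m∣m*n d′))))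

∑-splittings-∷ : ∀ q qs (f : Splitting → ℕ) →
  ∑ (splittings (q ∷ qs)) f ≡ ∑ (splittings qs) (f ∘ without q) + ∑ (splittings qs) (f ∘ with′ q)
∑-splittings-∷ q qs f = trans (∑-++ (map (without q) (splittings qs)) _ f)
  (cong₂ _+_ (∑-map (splittings qs) (without q) f) (∑-map (splittings qs) (with′ q) f))

-- Expanding `∏ (q + 1)` chooses `q` or 1 from each factor, and the chosen `q` form the codivisor.
∑-codivisors : ∀ qs → ∑ (splittings qs) codivisor ≡ product (map suc qs)
∑-codivisors []       = refl
∑-codivisors (q ∷ qs) = begin
  ∑ (splittings (q ∷ qs)) codivisor                                     ≡⟨ ∑-splittings-∷ q qs codivisor ⟩
  ∑ (splittings qs) (λ s → q * codivisor s) + ∑ (splittings qs) codivisor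
    ≡⟨ cong (_+ _) (∑-*ˡ (splittings qs) q codivisor) ⟩
  q * ∑ (splittings qs) codivisor + ∑ (splittings qs) codivisor
    ≡⟨ +-comm (q * ∑ (splittings qs) codivisor) _ ⟩
  suc q * ∑ (splittings qs) codivisor
    ≡⟨ cong (suc q *_) (∑-codivisors qs) ⟩
  suc q * product (map suc qs)                                            ∎
  where open ≡-Reasoning

-- The logarithmic derivative of the Euler product: Σ log d / d is at most Σ 1 / d times
-- Σ log q / (q + 1), the weights w q / y bounding lg q / (q + 1).
∑-weights : ∀ y (w : ℕ → ℕ) qs → All (λ q → y * lg q ≤ w q * suc q) qs →
  y * ∑ (splittings qs) (λ s → codivisor s * weight s) ≤ product (map suc qs) * ∑ qs w
∑-weights y w []       _        = ≤-reflexive (*-zeroʳ y)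
∑-weights y w (q ∷ qs) (le ∷ les) = begin
  y * ∑ (splittings (q ∷ qs)) (λ s → codivisor s * weight s)
    ≡⟨ cong (y *_) (∑-splittings-∷ q qs (λ s → codivisor s * weight s)) ⟩
  y * (∑ (splittings qs) (λ s → q * codivisor s * weight s) + ∑ (splittings qs) (λ s → codivisor s * (lg q + weight s)))
                                                              ≡⟨ cong (y *_) (cong₂ _+_ eq₁ eq₂) ⟩
  y * (q * D + (lg q * S + D))                                ≡⟨ lem₁ y q D (lg q) S ⟩
  suc q * (y * D) + S * (y * lg q)
    ≤⟨ +-mono-≤ (*-monoʳ-≤ (suc q) (∑-weights y w qs les)) (*-monoʳ-≤ S le) ⟩
  suc q * (S * ∑ qs w) + S * (w q * suc q)                    ≡⟨ lem₂ (suc q) S (∑ qs w) (w q) ⟩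
  suc q * S * (w q + ∑ qs w)                                  ∎
  where
  open ≤-Reasoning
  S = product (map suc qs)
  D = ∑ (splittings qs) (λ s → codivisor s * weight s)
  lem₁ : ∀ y q D l S → y * (q * D + (l * S + D)) ≡ suc q * (y * D) + S * (y * l)
  lem₁ = solve-∀
  lem₂ : ∀ q S W w → q * (S * W) + S * (w * q) ≡ q * S * (w + W)
  lem₂ = solve-∀
  lem₃ : ∀ e l g → e * (l + g) ≡ l * e + e * g
  lem₃ = solve-∀
  eq₁ : ∑ (splittings qs) (λ s → q * codivisor s * weight s) ≡ q * D
  eq₁ = trans (∑-cong (splittings qs) (λ {s} _ → *-assoc q (codivisor s) (weight s)))
    (∑-*ˡ (splittings qs) q _)
  eq₂ : ∑ (splittings qs) (λ s → codivisor s * (lg q + weight s)) ≡ lg q * S + D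
  eq₂ = trans (∑-cong (splittings qs) (λ {s} _ → lem₃ (codivisor s) (lg q) (weight s)))
    (trans (∑-+ (splittings qs) _ _)
      (cong (_+ D) (trans (∑-*ˡ (splittings qs) (lg q) codivisor) (cong (lg q *_) (∑-codivisors qs)))))

-- The value at d = 0 is junk.
_/₀_ : ℕ → ℕ → ℕ
n /₀ zero  = 0
n /₀ suc d = n / suc d

-- The terms with `2 ^ j ≤ d < 2 ^ suc j` are `2 ^ j` in number and at most `n / 2 ^ j` each, so
-- every dyadic block adds at most `n`. The term at 0 is 0 by convention.
harmonic : ∀ n j → ∑ (downFrom (2 ^ j)) (n /₀_) ≤ j * n
harmonic n zero    = z≤n
harmonic n (suc j) = begin
  ∑ (downFrom (2 ^ suc j)) (n /₀_)
    ≡⟨ cong (λ k → ∑ (downFrom (y + k)) (n /₀_)) (+-identityʳ y) ⟩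
  ∑ (downFrom (y + y)) (n /₀_)                             ≡⟨ ∑-downFrom-+ y y (n /₀_) ⟩
  ∑ (downFrom y) (n /₀_) + ∑ (downFrom y) (λ i → n /₀ (y + i))
    ≤⟨ +-mono-≤ (harmonic n j) (∑-mono (downFrom y) (λ {i} _ → mono y i {{y≢0}})) ⟩
  j * n + ∑ (downFrom y) (λ _ → _/_ n y {{y≢0}})
    ≡⟨ cong (j * n +_) (trans (∑-const (downFrom y) _) (cong (_* _/_ n y {{y≢0}}) (length-downFrom y))) ⟩
  j * n + y * _/_ n y {{y≢0}}
    ≤⟨ +-monoʳ-≤ (j * n) (≤-trans (≤-reflexive (*-comm y _)) (m/n*n≤m n y {{y≢0}})) ⟩
  j * n + n                                                ≡⟨ +-comm (j * n) n ⟩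
  suc j * n                                                ∎
  where
  open ≤-Reasoning
  y = 2 ^ j
  y≢0 = m^n≢0 2 j
  mono : ∀ y i .{{_ : NonZero y}} → n /₀ (y + i) ≤ n / y
  mono (suc y) i = /-monoʳ-≤ n (s≤s (m≤m+n y i))

-- Splittings of weight at least t = 2 (l + 1) contribute at most half of the
-- Euler product, by ∑-weights; the others have distinct divisors below 4 ^ t.
∏-suc-bound : ∀ {qs} l → All Prime qs → Unique qs → ∑ qs lg ≤ 2 ^ l →
  product (map suc qs) ≤ 8 * suc l * product qs
∏-suc-bound {qs} l primes uniq ∑lg≤ = begin
  S              ≤⟨ S≤2E ⟩
  2 * E          ≤⟨ *-monoʳ-≤ 2 E≤ ⟩
  2 * (2 * t * P) ≡⟨ lem₁ (suc l) P ⟩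
  8 * suc l * P  ∎
  where
  open ≤-Reasoning
  y = 2 ^ l
  -- By `D≤` the mean weight with respect to `codivisor` is at most `suc l`; the threshold is twice
  -- that, as in Markov's inequality.
  t = 2 * suc l
  P = product qs
  S = product (map suc qs)
  light? : Decidable (λ s → weight s < t)
  light? s = weight s <? t
  light = filter light? (splittings qs)
  E = ∑ light codivisor
  D = ∑ (splittings qs) (λ s → codivisor s * weight s)
  lem₁ : ∀ l P → 2 * (2 * (2 * l) * P) ≡ 8 * l * P
  lem₁ = solve-∀
  lem₂ : ∀ l E S → 2 * l * E + S * l ≡ l * (2 * E + S)
  lem₂ = solve-∀
  lem₃ : ∀ l S → 2 * l * S ≡ l * (S + S)
  lem₃ = solve-∀
  lem₄ : ∀ y s l → s * (y * l) ≡ y * (s * l)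
  lem₄ = solve-∀

  D≤ : D ≤ S * suc l
  D≤ = *-cancelˡ-≤ y {{m^n≢0 2 l}} (begin
    y * D
      ≤⟨ ∑-weights y (λ q → lg q * suc (multiplesUpTo y q)) qs (All.map weight-bound primes) ⟩
    S * ∑ qs (λ q → lg q * suc (multiplesUpTo y q))     ≤⟨ *-monoʳ-≤ S (mertens l primes uniq ∑lg≤) ⟩
    S * (y * suc l)                                     ≡⟨ lem₄ y S (suc l) ⟩
    y * (S * suc l)                                     ∎)
    where
    weight-bound : ∀ {q} → Prime q → y * lg q ≤ lg q * suc (multiplesUpTo y q) * suc q
    weight-bound {q} q-prime = begin
      y * lg q                                ≡⟨ *-comm y (lg q) ⟩
      lg q * y
        ≤⟨ *-monoʳ-≤ (lg q) (<⇒≤ (<[1+multiples]* y q {{prime⇒nonZero q-prime}})) ⟩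
      lg q * (suc (multiplesUpTo y q) * q)
        ≤⟨ *-monoʳ-≤ (lg q) (*-monoʳ-≤ (suc (multiplesUpTo y q)) (n≤1+n q)) ⟩
      lg q * (suc (multiplesUpTo y q) * suc q) ≡⟨ *-assoc (lg q) _ (suc q) ⟨
      lg q * suc (multiplesUpTo y q) * suc q  ∎

  tS≤ : t * S ≤ t * E + D
  tS≤ = begin
    t * S                                          ≡⟨ cong (t *_) (∑-codivisors qs) ⟨
    t * ∑ (splittings qs) codivisor                ≡⟨ ∑-*ˡ (splittings qs) t codivisor ⟨
    ∑ (splittings qs) (λ s → t * codivisor s)      ≤⟨ ∑-mono (splittings qs) (λ {s} _ → pointwise s) ⟩
    ∑ (splittings qs) (λ s → t * (codivisor s * 𝟙 (light? s)) + codivisor s * weight s)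
                                                  
                                                    ≡⟨ ∑-+ (splittings qs) (λ s → t * (codivisor s * 𝟙 (light? s))) _ ⟩
    ∑ (splittings qs) (λ s → t * (codivisor s * 𝟙 (light? s))) + D
                                                  
                                                    ≡⟨ cong (_+ D) (trans (∑-*ˡ (splittings qs) t _) (cong (t *_) (∑-𝟙 light? (splittings qs) codivisor))) ⟩
    t * E + D                                      ∎
    where
    pointwise : ∀ s → t * codivisor s ≤ t * (codivisor s * 𝟙 (light? s)) + codivisor s * weight s
    pointwise s with light? s
    ... | yes _ = ≤-trans (≤-reflexive (cong (t *_) (sym (*-identityʳ (codivisor s))))) (m≤m+n _ (codivisor s * weight s))
    ... | no ≮t = ≤-trans (≤-reflexive (*-comm t (codivisor s)))
                    (≤-trans (*-monoʳ-≤ (codivisor s) (≮⇒≥ ≮t)) (m≤n+m _ (t * (codivisor s * 0))))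

  S≤2E : S ≤ 2 * E
  S≤2E = +-cancelʳ-≤ S S (2 * E) (*-cancelˡ-≤ (suc l) (begin
    suc l * (S + S)          ≡⟨ lem₃ (suc l) S ⟨
    2 * suc l * S            ≤⟨ tS≤ ⟩
    2 * suc l * E + D        ≤⟨ +-monoʳ-≤ (2 * suc l * E) D≤ ⟩
    2 * suc l * E + S * suc l ≡⟨ lem₂ (suc l) E S ⟩
    suc l * (2 * E + S)      ∎))

  codivisor≡ : ∀ {d e} → d * e ≡ P → e ≡ P /₀ d
  codivisor≡ {zero}  {e} eq = contradiction eq (<⇒≢ (productOfPrimes≥1 primes))
  codivisor≡ {suc d} {e} eq = sym (trans (cong (_/ suc d) (trans (sym eq) (*-comm (suc d) e))) (m*n/n≡m e (suc d)))

  E≤ : E ≤ 2 * t * P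
  E≤ = begin
    ∑ light codivisor
      ≡⟨ ∑-cong light (λ {s} s∈ → codivisor≡ {divisor s} (All.lookup (divisor*codivisor primes) (proj₁ (∈-filter⁻ light? s∈)))) ⟩
    ∑ light (λ s → P /₀ divisor s)      ≡⟨ ∑-map light divisor (P /₀_) ⟨
    ∑ (map divisor light) (P /₀_)       ≤⟨ ∑-unique-⊆ (P /₀_) light-unique small ⟩
    ∑ (downFrom (2 ^ (2 * t))) (P /₀_)  ≤⟨ harmonic P (2 * t) ⟩
    2 * t * P                           ∎
    where
    light-unique : Unique (map divisor light)
    light-unique = AllPairs.map⁺ (AllPairs.filter⁺ light? (AllPairs.map⁻ (divisors-unique primes uniq)))
    small : ∀ {d} → d ∈ map divisor light → d ∈ downFrom (2 ^ (2 * t))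
    small d∈ with ∈-map⁻ divisor d∈
    ... | s , s∈ , refl with ∈-filter⁻ light? s∈
    ...   | s∈′ , w<t = ∈-downFrom⁺ (begin-strict
      divisor s     ≤⟨ All.lookup (divisor≤4^weight primes) s∈′ ⟩
      4 ^ weight s  <⟨ ^-monoʳ-< 4 (s≤s (s≤s z≤n)) w<t ⟩
      4 ^ t         ≡⟨ ^-*-assoc 2 2 t ⟩
      2 ^ (2 * t)   ∎)

-- Here `l` plays the role of `log log k`. In 16 the factor 2 comes from passing to `∏ (1 + 1 / q)`
-- and the factor 8 from `∏-suc-bound`.
totient-lower : ∀ l k .{{_ : NonZero k}} → k ≤ 2 ^ (2 ^ l) → k ≤ 16 * suc l * length (units k)
totient-lower l k k≤ = *-cancelʳ-≤ k (16 * suc l * φ) (P * P) (begin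
  k * (P * P)                    ≤⟨ *-monoʳ-≤ k (primesOf-square k) ⟩
  k * (2 * (P⁻ * P⁺))            ≡⟨ lem₁ k P⁻ P⁺ ⟩
  2 * (k * P⁻ * P⁺)              ≤⟨ *-monoʳ-≤ 2 (*-mono-≤ (units-lower k) (∏-suc-bound l primes uniq ∑lg≤)) ⟩
  2 * (φ * P * (8 * suc l * P))  ≡⟨ lem₂ φ P (suc l) ⟩
  16 * suc l * φ * (P * P)       ∎)
  where
  open ≤-Reasoning
  qs = primesOf k
  primes = primesOf-prime k
  uniq = primesOf-unique k
  ∑lg≤ = ∑lg-prime-divisors primes uniq (primesOf-∣ k) k≤
  φ  = length (units k)
  P  = product qs
  P⁻ = product (map pred qs)
  P⁺ = product (map suc qs)
  instance
    _ : NonZero (P * P)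
    _ = m*n≢0 P P {{productOfPrimes≢0 primes}} {{productOfPrimes≢0 primes}}
  lem₁ : ∀ k a b → k * (2 * (a * b)) ≡ 2 * (k * a * b)
  lem₁ = solve-∀
  lem₂ : ∀ φ P l → 2 * (φ * P * (8 * l * P)) ≡ 16 * l * φ * (P * P)
  lem₂ = solve-∀

-- Loads

load : (ℕ → ℕ) → ℕ → List ℕ → ℕ
load h b X = length (filter (λ x → h x ≟ b) X)

load-∑ : ∀ h b X → load h b X ≡ ∑ X (λ x → 𝟙 (h x ≟ b))
load-∑ h b X = sym (begin
  ∑ X (λ x → 𝟙 (h x ≟ b))              ≡⟨ ∑-cong X (λ _ → *-identityˡ _) ⟨
  ∑ X (λ x → 1 * 𝟙 (h x ≟ b))          ≡⟨ ∑-𝟙 (λ x → h x ≟ b) X (λ _ → 1) ⟩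
  ∑ (filter (λ x → h x ≟ b) X) (λ _ → 1) ≡⟨ ∑-const (filter (λ x → h x ≟ b) X) 1 ⟩
  load h b X * 1                       ≡⟨ *-identityʳ _ ⟩
  load h b X                           ∎)
  where open ≡-Reasoning

∈⇒≤⨆ : ∀ (f : ℕ → ℕ) {bs b} → b ∈ bs → f b ≤ foldr _⊔_ 0 (map f bs)
∈⇒≤⨆ f (here refl) = m≤m⊔n _ _
∈⇒≤⨆ f {c ∷ _} (there b∈) = m≤n⇒m≤o⊔n (f c) (∈⇒≤⨆ f b∈)

⨆≤ : ∀ (f : ℕ → ℕ) {bs K} → (∀ {b} → b ∈ bs → f b ≤ K) → foldr _⊔_ 0 (map f bs) ≤ K
⨆≤ f {[]}     h = z≤n
⨆≤ f {b ∷ bs} h = ⊔-lub (h (here refl)) (⨆≤ f (h ∘ there))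

load≤maxload : ∀ {n b} h X → b < n → load h b X ≤ maxload n h X
load≤maxload h X b<n = ∈⇒≤⨆ (λ b → load h b X) (∈-upTo⁺ b<n)

term≤∑ : ∀ {xs : List A} {x} (f : A → ℕ) → x ∈ xs → f x ≤ ∑ xs f
term≤∑ f (here refl) = m≤m+n _ _
term≤∑ {xs = y ∷ _} f (there x∈) = m≤n⇒m≤o+n (f y) (term≤∑ f x∈)

-- If F x lies in bin b, then G x lies in one of 2 s + 1 consecutive bins; the
-- shift by s * pred n stands for − s modulo n.
maxload-shift : ∀ n .{{_ : NonZero n}} s {h h′ : ℕ → ℕ} (F G : ℕ → ℕ) X →
  (∀ {x} → x ∈ X → h x ≡ F x % n) → (∀ {x} → x ∈ X → h′ x ≡ G x % n) →
  (∀ {x} → x ∈ X → F x ≤ G x + s) → (∀ {x} → x ∈ X → G x ≤ F x + s) →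
  maxload n h X ≤ suc (2 * s) * maxload n h′ X
maxload-shift n s {h} {h′} F G X h≡ h′≡ F≤ G≤ = ⨆≤ (λ b → load h b X) {upTo n} λ {b} _ → begin
  load h b X                                             ≡⟨ load-∑ h b X ⟩
  ∑ X (λ x → 𝟙 (h x ≟ b))                                ≤⟨ ∑-mono X (pointwise b) ⟩
  ∑ X (λ x → ∑ shifts (λ i → 𝟙 (h′ x ≟ bin b i)))        ≡⟨ ∑-swap X shifts (λ x i → 𝟙 (h′ x ≟ bin b i)) ⟩
  ∑ shifts (λ i → ∑ X (λ x → 𝟙 (h′ x ≟ bin b i)))
    ≤⟨ ∑-mono shifts (λ {i} _ → ≤-trans (≤-reflexive (sym (load-∑ h′ (bin b i) X))) (load≤maxload h′ X (m%n<n _ n))) ⟩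
  ∑ shifts (λ _ → maxload n h′ X)                        ≡⟨ ∑-const shifts _ ⟩
  length shifts * maxload n h′ X
    ≡⟨ cong (_* maxload n h′ X) (length-downFrom (suc (2 * s))) ⟩
  suc (2 * s) * maxload n h′ X                           ∎
  where
  open ≤-Reasoning
  shifts = downFrom (suc (2 * s))
  bin : ℕ → ℕ → ℕ
  bin b i = (b + (i + s * pred n)) % n
  lem₁ : ∀ G s → G + s + s ≡ G + 2 * s
  lem₁ = solve-∀
  rearrange : ∀ F G i → F + i ≡ G + s → F + (i + s * pred n) ≡ G + s * n
  rearrange F G i eq = begin-equality
    F + (i + s * pred n)  ≡⟨ +-assoc F i _ ⟨
    F + i + s * pred n    ≡⟨ cong (_+ s * pred n) eq ⟩
    G + s + s * pred n    ≡⟨ +-assoc G s _ ⟩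
    G + (s + s * pred n)  ≡⟨ cong (G +_) (*-suc s (pred n)) ⟨
    G + s * suc (pred n)  ≡⟨ cong (λ l → G + s * l) (suc-pred n) ⟩
    G + s * n             ∎
  bin≡ : ∀ F G → F ≤ G + s → bin (F % n) (G + s ∸ F) ≡ G % n
  bin≡ F G F≤ = begin-equality
    (F % n + j) % n            ≡⟨ %-distribˡ-+ (F % n) j n ⟩
    (F % n % n + j % n) % n    ≡⟨ cong (λ l → (l + j % n) % n) (m%n%n≡m%n F n) ⟩
    (F % n + j % n) % n        ≡⟨ %-distribˡ-+ F j n ⟨
    (F + j) % n                ≡⟨ cong (_% n) (rearrange F G (G + s ∸ F) (m+[n∸m]≡n F≤)) ⟩
    (G + s * n) % n            ≡⟨ [m+kn]%n≡m%n G s n ⟩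
    G % n                      ∎
    where
    j = G + s ∸ F + s * pred n
  pointwise : ∀ b {x} → x ∈ X → 𝟙 (h x ≟ b) ≤ ∑ shifts (λ i → 𝟙 (h′ x ≟ bin b i))
  pointwise b {x} x∈ with h x ≟ b
  ... | no _    = z≤n
  ... | yes refl = ≤-trans one (term≤∑ (λ i → 𝟙 (h′ x ≟ bin (h x) i)) i∈)
    where
    -- The shift with `F x + i = G x + s`; the two closeness hypotheses place it between 0 and
    -- `2 * s`.
    i = G x + s ∸ F x
    i∈ : i ∈ shifts
    i∈ = ∈-downFrom⁺ (s≤s (m≤n+o⇒m∸n≤o (G x + s) (F x) (≤-trans (+-monoˡ-≤ s (G≤ x∈))
      (≤-reflexive (lem₁ (F x) s)))))
    one : 1 ≤ 𝟙 (h′ x ≟ bin (h x) i)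
    one with h′ x ≟ bin (h x) i
    ... | yes _ = ≤-refl
    ... | no ≢ = contradiction (trans (h′≡ x∈) (trans (sym (bin≡ (F x) (G x) (F≤ x∈))) (cong (λ l → bin l i) (sym (h≡ x∈))))) ≢

-- Floors of fractions

/-mono-cross : ∀ {p q} a b .{{_ : NonZero a}} .{{_ : NonZero b}} → p * b ≤ q * a → p / a ≤ q / b
/-mono-cross {p} {q} a b pb≤qa = begin
  p / a               ≡⟨ m*n/n≡m (p / a) b ⟨
  p / a * b / b       ≤⟨ /-monoˡ-≤ b (*-cancelʳ-≤ (p / a * b) q a (begin
    p / a * b * a       ≡⟨ lem (p / a) b a ⟩
    p / a * a * b       ≤⟨ *-monoˡ-≤ b (m/n*n≤m p a) ⟩
    p * b               ≤⟨ pb≤qa ⟩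
    q * a               ∎)) ⟩
  q / b               ∎
  where
  open ≤-Reasoning
  lem : ∀ x b a → x * b * a ≡ x * a * b
  lem = solve-∀

/-cong-cross : ∀ {p q} a b .{{_ : NonZero a}} .{{_ : NonZero b}} → p * b ≡ q * a → p / a ≡ q / b
/-cong-cross a b eq = ≤-antisym (/-mono-cross a b (≤-reflexive eq)) (/-mono-cross b a (≤-reflexive (sym eq)))

-- The first hypothesis is A / a ≤ B / b + 1 / D with denominators cleared.
floor-close : ∀ v s D {A B} a b .{{_ : NonZero D}} .{{_ : NonZero a}} .{{_ : NonZero b}} →
  A * b * D ≤ (B * D + b) * a → v ≤ s * D → v * A / a ≤ v * B / b + s
floor-close v s D {A} {B} a b A≤ v≤ = begin
  v * A / a               ≤⟨ /-mono-cross a b (*-cancelʳ-≤ (v * A * b) ((v * B + s * b) * a) D cross) ⟩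
  (v * B + s * b) / b     ≡⟨ +-distrib-/-∣ʳ (v * B) (n∣m*n s) ⟩
  v * B / b + s * b / b   ≡⟨ cong (v * B / b +_) (m*n/n≡m s b) ⟩
  v * B / b + s           ∎
  where
  open ≤-Reasoning
  lem₁ : ∀ v A b D → v * A * b * D ≡ v * (A * b * D)
  lem₁ = solve-∀
  lem₂ : ∀ v B b D a → v * ((B * D + b) * a) ≡ v * B * D * a + v * (b * a)
  lem₂ = solve-∀
  lem₃ : ∀ v B s b a D → v * B * D * a + s * D * (b * a) ≡ (v * B + s * b) * a * D
  lem₃ = solve-∀
  cross : v * A * b * D ≤ (v * B + s * b) * a * D
  cross = begin
    v * A * b * D                          ≡⟨ lem₁ v A b D ⟩
    v * (A * b * D)                        ≤⟨ *-monoʳ-≤ v A≤ ⟩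
    v * ((B * D + b) * a)                  ≡⟨ lem₂ v B b D a ⟩
    v * B * D * a + v * (b * a)            ≤⟨ +-monoʳ-≤ (v * B * D * a) (*-monoˡ-≤ (b * a) v≤) ⟩
    v * B * D * a + s * D * (b * a)        ≡⟨ lem₃ v B s b a D ⟩
    (v * B + s * b) * a * D                ∎

-- Reducing `c * x` modulo `k` removes whole turns, each of which changes the floor by a multiple of
-- `n`. This gives the hash the form of real hashing with multiplier `c / k`.
shBin≡ : ∀ n k c x .{{_ : NonZero n}} .{{_ : NonZero k}} → shBin n k c x ≡ (n * x * c / k) % n
shBin≡ n k@(suc _) c x = sym (begin
  n * x * c / k % n
    ≡⟨ cong (λ l → l / k % n) (trans (lem₀ n x c) (trans (cong (n *_) (m≡m%n+[m/n]*n z k)) (lem₁ n (z % k) (z / k) k))) ⟩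
  (n * (z % k) + n * (z / k) * k) / k % n
    ≡⟨ cong (_% n) (+-distrib-/-∣ʳ (n * (z % k)) (n∣m*n (n * (z / k)))) ⟩
  (n * (z % k) / k + n * (z / k) * k / k) % n
    ≡⟨ cong (λ l → (n * (z % k) / k + l) % n) (trans (m*n/n≡m (n * (z / k)) k) (*-comm n (z / k))) ⟩
  (n * (z % k) / k + z / k * n) % n           ≡⟨ [m+kn]%n≡m%n (n * (z % k) / k) (z / k) n ⟩
  n * (z % k) / k % n                         ≡⟨ m<n⇒m%n≡m (m<n*o⇒m/o<n (*-monoʳ-< n (m%n<n z k))) ⟩
  n * (z % k) / k                             ∎)
  where
  open ≡-Reasoning
  z = c * x
  lem₀ : ∀ n x c → n * x * c ≡ n * (c * x)
  lem₀ = solve-∀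
  lem₁ : ∀ n r q k → n * (r + q * k) ≡ n * r + n * q * k
  lem₁ = solve-∀

-- Real hashing with multiplier `(2 l + 1) / 2 M`, the midpoint of the grid interval from `l / M` to
-- `(l + 1) / M`.
gridBin : ∀ (n M : ℕ) .{{_ : NonZero n}} .{{_ : NonZero M}} → ℕ → ℕ → ℕ
gridBin n M l x = (_/_ (n * x * suc (2 * l)) (2 * M) {{m*n≢0 2 M}}) % n

-- The inequalities place both multipliers, (2 l + 1) / 2 M and c / k, in [β / B, (β + 1) / B].
maxload-close : ∀ n M k c l B β s X .{{_ : NonZero n}} .{{_ : NonZero M}} .{{_ : NonZero k}} .{{_ : NonZero B}} →
  (∀ {x} → x ∈ X → n * x ≤ s * B) →
  c * B ≤ suc β * k → β * k ≤ c * B → suc (2 * l) * B ≤ suc β * (2 * M) → β * (2 * M) ≤ suc (2 * l) * B →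
  maxload n (gridBin n M l) X ≤ suc (2 * s) * maxload n (shBin n k c) X ×
  maxload n (shBin n k c) X ≤ suc (2 * s) * maxload n (gridBin n M l) X
maxload-close n M k c l B β s X nx≤ c≤ ≤c l≤ ≤l =
  maxload-shift n s F G X (λ _ → refl) (λ {x} _ → shBin≡ n k c x) F≤G G≤F ,
  maxload-shift n s G F X (λ {x} _ → shBin≡ n k c x) (λ _ → refl) G≤F F≤G
  where
  open ≤-Reasoning
  instance
    _ : NonZero (2 * M)
    _ = m*n≢0 2 M
  F G : ℕ → ℕ
  F x = n * x * suc (2 * l) / (2 * M)
  G x = n * x * c / k
  close : ∀ {A B′ a b} → A * B ≤ suc β * a → β * b ≤ B′ * B → A * b * B ≤ (B′ * B + b) * a
  close {A} {B′} {a} {b} A≤ ≤B′ = begin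
    A * b * B               ≡⟨ lem₁ A b B ⟩
    A * B * b               ≤⟨ *-monoˡ-≤ b A≤ ⟩
    suc β * a * b           ≡⟨ lem₂ β a b ⟩
    (β * b + b) * a         ≤⟨ *-monoˡ-≤ a (+-monoˡ-≤ b ≤B′) ⟩
    (B′ * B + b) * a        ∎
    where
    lem₁ : ∀ A b B → A * b * B ≡ A * B * b
    lem₁ = solve-∀
    lem₂ : ∀ β a b → suc β * a * b ≡ (β * b + b) * a
    lem₂ = solve-∀
  F≤G : ∀ {x} → x ∈ X → F x ≤ G x + s
  F≤G {x} x∈ = floor-close (n * x) s B (2 * M) k (close {suc (2 * l)} {c} {2 * M} {k} l≤ ≤c) (nx≤ x∈)
  G≤F : ∀ {x} → x ∈ X → G x ≤ F x + s
  G≤F {x} x∈ = floor-close (n * x) s B k (2 * M) (close {c} {suc (2 * l)} {k} {2 * M} c≤ ≤l) (nx≤ x∈)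

-- Fractions

frac : (i d : ℕ) .{{_ : NonZero d}} → ℚ
frac i d = (pos i) ℚ./ d

toℚᵘ-frac : ∀ i d → toℚᵘ (frac i (suc d)) ℚᵘ.≃ mkℚᵘ (pos i) d
toℚᵘ-frac i d = ℚ.toℚᵘ-fromℚᵘ (mkℚᵘ (pos i) d)

frac-≡ : ∀ {i d j e} .{{_ : NonZero d}} .{{_ : NonZero e}} → i * e ≡ j * d → frac i d ≡ frac j e
frac-≡ {i} {suc d} {j} {suc e} eq = ℚ.fromℚᵘ-cong {mkℚᵘ (pos i) d} {mkℚᵘ (pos j) e}
  (*≡* (trans (sym (ℤ.pos-* i (suc e))) (trans (cong pos eq) (ℤ.pos-* j (suc d)))))

frac-cancel-≤ : ∀ {i d j e} .{{_ : NonZero d}} .{{_ : NonZero e}} → frac i d ℚ.≤ frac j e → i * e ≤ j * d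
frac-cancel-≤ {i} {suc d} {j} {suc e} le = ℤ.drop‿+≤+ (subst₂ ℤ._≤_ (sym (ℤ.pos-* i (suc e))) (sym (ℤ.pos-* j (suc d)))
  (ℚᵘ.drop-*≤* (ℚᵘ.≤-respˡ-≃ (toℚᵘ-frac i d) (ℚᵘ.≤-respʳ-≃ (toℚᵘ-frac j e) (ℚ.toℚᵘ-mono-≤ le)))))

frac-≤ : ∀ {i d j e} .{{_ : NonZero d}} .{{_ : NonZero e}} → i * e ≤ j * d → frac i d ℚ.≤ frac j e
frac-≤ {i} {suc d} {j} {suc e} le = ℚ.toℚᵘ-cancel-≤
  (ℚᵘ.≤-respˡ-≃ (ℚᵘ.≃-sym (toℚᵘ-frac i d)) (ℚᵘ.≤-respʳ-≃ (ℚᵘ.≃-sym (toℚᵘ-frac j e))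
    (*≤* (subst₂ ℤ._≤_ (ℤ.pos-* i (suc e)) (ℤ.pos-* j (suc d)) (ℤ.+≤+ le)))))

frac-injective : ∀ {i j} d .{{_ : NonZero d}} → frac i d ≡ frac j d → i ≡ j
frac-injective {i} {j} d eq = *-cancelʳ-≡ i j d
  (≤-antisym (frac-cancel-≤ {i} {d} {j} {d} (ℚ.≤-reflexive eq)) (frac-cancel-≤ {j} {d} {i} {d} (ℚ.≤-reflexive (sym eq))))

frac-* : ∀ i d j e .{{_ : NonZero d}} .{{_ : NonZero e}} .{{_ : NonZero (d * e)}} → frac i d ℚ.* frac j e ≡ frac (i * j) (d * e)
frac-* i (suc d) j (suc e) = ℚ.toℚᵘ-injective (ℚᵘ.≃-trans (ℚ.toℚᵘ-homo-* (frac i (suc d)) (frac j (suc e)))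
  (ℚᵘ.≃-trans (ℚᵘ.*-cong (toℚᵘ-frac i d) (toℚᵘ-frac j e))
    (ℚᵘ.≃-trans (*≡* (cong (ℤ._* (pos (suc d * suc e))) (sym (ℤ.pos-* i j)))) (ℚᵘ.≃-sym (toℚᵘ-frac (i * j) (e + d * suc e))))))

ℕtoℚ-+ : ∀ i j → ℕtoℚ (i + j) ≡ ℕtoℚ i ℚ.+ ℕtoℚ j
ℕtoℚ-+ i j = ℚ.toℚᵘ-injective (ℚᵘ.≃-trans (toℚᵘ-frac (i + j) 0) (ℚᵘ.≃-sym
  (ℚᵘ.≃-trans (ℚ.toℚᵘ-homo-+ (frac i 1) (frac j 1))
    (ℚᵘ.≃-trans (ℚᵘ.+-cong (toℚᵘ-frac i 0) (toℚᵘ-frac j 0))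
      (*≡* (cong (ℤ._* pos 1) (cong₂ ℤ._+_ (ℤ.*-identityʳ (pos i)) (ℤ.*-identityʳ (pos j)))))))))

ℕtoℚ-* : ∀ i j → ℕtoℚ (i * j) ≡ ℕtoℚ i ℚ.* ℕtoℚ j
ℕtoℚ-* i j = sym (frac-* i 1 j 1)

ℕtoℚ-≤ : ∀ {i j} → i ≤ j → ℕtoℚ i ℚ.≤ ℕtoℚ j
ℕtoℚ-≤ {i} {j} le = frac-≤ {i} {1} {j} {1} (*-monoˡ-≤ 1 le)

frac*denominator : ∀ i d .{{_ : NonZero d}} → frac i d ℚ.* ℕtoℚ d ≡ ℕtoℚ i
frac*denominator i d = trans (frac-* i d d 1 {{it}} {{_}} {{d*1≢0}}) (frac-≡ {i * d} {d * 1} {i} {1} {{d*1≢0}} (lem i d))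
  where
  d*1≢0 : NonZero (d * 1)
  d*1≢0 = m*n≢0 d 1
  it : NonZero d
  it = >-nonZero (>-nonZero⁻¹ d)
  lem : ∀ i d → i * d * 1 ≡ i * (d * 1)
  lem = solve-∀

ℕtoℚ-nonNeg : ∀ i → ℚ.NonNegative (ℕtoℚ i)
ℕtoℚ-nonNeg i = ℚ.normalize-nonNeg i 1

ℕtoℚ-pos : ∀ i .{{_ : NonZero i}} → ℚ.Positive (ℕtoℚ i)
ℕtoℚ-pos i = ℚ.normalize-pos i 1

*-cancelʳ-≡-ℕtoℚ : ∀ {p q} d .{{_ : NonZero d}} → p ℚ.* ℕtoℚ d ≡ q ℚ.* ℕtoℚ d → p ≡ q
*-cancelʳ-≡-ℕtoℚ d eq = ℚ.≤-antisym
  (ℚ.*-cancelʳ-≤-pos (ℕtoℚ d) {{ℕtoℚ-pos d}} (ℚ.≤-reflexive eq))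
  (ℚ.*-cancelʳ-≤-pos (ℕtoℚ d) {{ℕtoℚ-pos d}} (ℚ.≤-reflexive (sym eq)))

frac-unique : ∀ {q} i d .{{_ : NonZero d}} → q ℚ.* ℕtoℚ d ≡ ℕtoℚ i → q ≡ frac i d
frac-unique i d eq = *-cancelʳ-≡-ℕtoℚ d (trans eq (sym (frac*denominator i d)))

-- Averages and maxima

sumℚ-map : ∀ (g : A → ℕ) xs → sumℚ (map (ℕtoℚ ∘ g) xs) ≡ ℕtoℚ (∑ xs g)
sumℚ-map g []       = refl
sumℚ-map g (x ∷ xs) = trans (cong (ℕtoℚ (g x) ℚ.+_) (sumℚ-map g xs)) (sym (ℕtoℚ-+ (g x) (∑ xs g)))

-- With the denominator cleared the identity also covers the empty list, and averages become sums
-- that can be compared in ℕ.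
avgℚ*length : ∀ xs → avgℚ xs ℚ.* ℕtoℚ (length xs) ≡ sumℚ xs
avgℚ*length []       = refl
avgℚ*length (q ∷ qs) = begin
  s ℚ.* frac 1 l ℚ.* ℕtoℚ l   ≡⟨ ℚ.*-assoc s (frac 1 l) (ℕtoℚ l) ⟩
  s ℚ.* (frac 1 l ℚ.* ℕtoℚ l) ≡⟨ cong (s ℚ.*_) (frac*denominator 1 l) ⟩
  s ℚ.* 1ℚ                    ≡⟨ ℚ.*-identityʳ s ⟩
  s                           ∎
  where
  open ≡-Reasoning
  s = sumℚ (q ∷ qs)
  l = suc (length qs)

expSH*length : ∀ k n X →
  expSH k n X ℚ.* ℕtoℚ (length (units k)) ≡ ℕtoℚ (∑ (units k) (λ c → maxload n (shBin n k c) X))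
expSH*length k n X = begin
  expSH k n X ℚ.* ℕtoℚ (length (units k))
    ≡⟨ cong (λ l → expSH k n X ℚ.* ℕtoℚ l) (length-map _ (units k)) ⟨
  expSH k n X ℚ.* ℕtoℚ (length (map (λ c → ℕtoℚ (maxload n (shBin n k c) X)) (units k)))
                                                  
                                                    ≡⟨ avgℚ*length (map (λ c → ℕtoℚ (maxload n (shBin n k c) X)) (units k)) ⟩
  sumℚ (map (λ c → ℕtoℚ (maxload n (shBin n k c) X)) (units k))
    ≡⟨ sumℚ-map (λ c → maxload n (shBin n k c) X) (units k) ⟩
  ℕtoℚ (∑ (units k) (λ c → maxload n (shBin n k c) X)) ∎
  where
  open ≡-Reasoning

∈⇒≤maxℚ : ∀ {q qs} → q ∈ qs → q ℚ.≤ maxℚ qs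
∈⇒≤maxℚ {q} {_ ∷ qs} (here refl) = ℚ.p≤p⊔q q (maxℚ qs)
∈⇒≤maxℚ {q} {r ∷ qs} (there q∈) = ℚ.≤-trans (∈⇒≤maxℚ q∈) (ℚ.p≤q⊔p r (maxℚ qs))

maxℚ-map≤ : ∀ (f : A → ℚ) {xs b} → 0ℚ ℚ.≤ b → (∀ {x} → x ∈ xs → f x ℚ.≤ b) → maxℚ (map f xs) ℚ.≤ b
maxℚ-map≤ f {[]}     0≤b h = 0≤b
maxℚ-map≤ f {x ∷ xs} 0≤b h = ℚ.⊔-lub (h (here refl)) (maxℚ-map≤ f 0≤b (h ∘ there))

0≤maxℚ : ∀ qs → 0ℚ ℚ.≤ maxℚ qs
0≤maxℚ []       = ℚ.≤-refl
0≤maxℚ (q ∷ qs) = ℚ.≤-trans (0≤maxℚ qs) (ℚ.p≤q⊔p q (maxℚ qs))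

-- The integral as an average over grid midpoints

fracBin : ∀ (n s d : ℕ) .{{_ : NonZero n}} .{{_ : NonZero d}} → ℕ → ℕ
fracBin n s d x = (n * x * s / d) % n

-- `realBin` reads the numerator and denominator in lowest terms; cross multiplication shows that
-- the floor is the same for the unreduced fraction.
realBin-frac : ∀ n s d x .{{_ : NonZero n}} .{{_ : NonZero d}} → realBin n (frac s d) x ≡ fracBin n s d x
realBin-frac n@(suc _) s d@(suc d-1) x =
  cong (_% n) (/-cong-cross {n * ℤ.∣ ↥ frac s d ∣ * x} {n * x * s} (↧ₙ frac s d) d {{it}} (trans (lem₁ n ℤ.∣ ↥ frac s d ∣ x d) (trans (cong (n * x *_) cross) (lem₂ (n * x) s (↧ₙ frac s d)))))
  where
  it : NonZero (↧ₙ frac s d)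
  it = _
  lem₁ : ∀ n a x d → n * a * x * d ≡ n * x * (a * d)
  lem₁ = solve-∀
  lem₂ : ∀ v s e → v * (s * e) ≡ v * s * e
  lem₂ = solve-∀
  ℤ-cross : ↥ frac s d ℤ.* pos d ≡ pos s ℤ.* pos (↧ₙ frac s d)
  ℤ-cross = subst₂ (λ i j → i ℤ.* pos d ≡ pos s ℤ.* j) (ℚ.↥ᵘ-toℚᵘ (frac s d)) (ℚ.↧ᵘ-toℚᵘ (frac s d)) (ℚᵘ.drop-*≡* (toℚᵘ-frac s d-1))
  cross : ℤ.∣ ↥ frac s d ∣ * d ≡ s * ↧ₙ frac s d
  cross = trans (sym (ℤ.abs-* (↥ frac s d) (pos d))) (trans (cong ℤ.∣_∣ ℤ-cross) (ℤ.abs-* (pos s) (pos (↧ₙ frac s d))))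

maxload-cong : ∀ n {h h′ : ℕ → ℕ} X → (∀ {x} → x ∈ X → h x ≡ h′ x) → maxload n h X ≡ maxload n h′ X
maxload-cong n {h} {h′} X eq = ≤-antisym (one-way h h′ eq) (one-way h′ h (sym ∘ eq))
  where
  open ≤-Reasoning
  one-way : ∀ h h′ → (∀ {x} → x ∈ X → h x ≡ h′ x) → maxload n h X ≤ maxload n h′ X
  one-way h h′ eq = ⨆≤ (λ b → load h b X) {upTo n} λ {b} b∈ → begin
    load h b X                 ≡⟨ load-∑ h b X ⟩
    ∑ X (λ x → 𝟙 (h x ≟ b))    ≡⟨ ∑-cong X (λ x∈ → cong (λ l → 𝟙 (l ≟ b)) (eq x∈)) ⟩
    ∑ X (λ x → 𝟙 (h′ x ≟ b))   ≡⟨ load-∑ h′ b X ⟨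
    load h′ b X                ≤⟨ load≤maxload h′ X (∈-upTo⁻ b∈) ⟩
    maxload n h′ X             ∎

-- The list `bs` holds the breakpoints in units of `1 / M`. By `constant`, the value of `f` at the
-- midpoint of a gap agrees with `g` on every grid interval inside that gap, so the gap can be split
-- into grid intervals.
module Grid (M : ℕ) .{{_ : NonZero M}} (f : ℚ → ℚ) (g : ℕ → ℕ) (bs : List ℕ) (bs≤M : ∀ {b} → b ∈ bs → b ≤ M) (M∈bs : M ∈ bs)
  (constant : ∀ {i j l} → (∀ {b} → b ∈ bs → b ≤ i ⊎ j ≤ b) → i ≤ l → l < j → j ≤ M → f (frac (i + j) (2 * M) {{m*n≢0 2 M}}) ≡ ℕtoℚ (g l))
  where

  private instance
    2M≢0 : NonZero (2 * M)
    2M≢0 = m*n≢0 2 M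

  midpoint : ∀ i j → (frac i M ℚ.+ frac j M) ℚ.* ½ ≡ frac (i + j) (2 * M)
  midpoint i j = frac-unique (i + j) (2 * M) (begin
    (frac i M ℚ.+ frac j M) ℚ.* ½ ℚ.* ℕtoℚ (2 * M)
      ≡⟨ cong ((frac i M ℚ.+ frac j M) ℚ.* ½ ℚ.*_) (ℕtoℚ-* 2 M) ⟩
    (frac i M ℚ.+ frac j M) ℚ.* ½ ℚ.* (ℕtoℚ 2 ℚ.* ℕtoℚ M)
      ≡⟨ solve 3 (λ a b m → (a :+ b) :* con ½ :* (con (ℕtoℚ 2) :* m) := a :* m :+ b :* m) refl (frac i M) (frac j M) (ℕtoℚ M) ⟩
    frac i M ℚ.* ℕtoℚ M ℚ.+ frac j M ℚ.* ℕtoℚ M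
      ≡⟨ cong₂ ℚ._+_ (frac*denominator i M) (frac*denominator j M) ⟩
    ℕtoℚ i ℚ.+ ℕtoℚ j                                        ≡⟨ ℕtoℚ-+ i j ⟨
    ℕtoℚ (i + j)                                             ∎)
    where
    open ≡-Reasoning
    open +-*-Solver

  piece : ∀ i d q → (∀ {t} → t < d → q ≡ ℕtoℚ (g (i + t))) →
    (frac (i + d) M ℚ.- frac i M) ℚ.* q ℚ.* ℕtoℚ M ≡ ℕtoℚ (∑ (downFrom d) (λ t → g (i + t)))
  piece i d q q≡ = begin
    (frac (i + d) M ℚ.- frac i M) ℚ.* q ℚ.* ℕtoℚ M
      ≡⟨ solve 4 (λ a b q m → (a :- b) :* q :* m := (a :* m :- b :* m) :* q) refl (frac (i + d) M) (frac i M) q (ℕtoℚ M) ⟩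
    (frac (i + d) M ℚ.* ℕtoℚ M ℚ.- frac i M ℚ.* ℕtoℚ M) ℚ.* q
      ≡⟨ cong₂ (λ a b → (a ℚ.- b) ℚ.* q) (trans (frac*denominator (i + d) M) (ℕtoℚ-+ i d)) (frac*denominator i M) ⟩
    (ℕtoℚ i ℚ.+ ℕtoℚ d ℚ.- ℕtoℚ i) ℚ.* q
      ≡⟨ solve 3 (λ a b q → (a :+ b :- a) :* q := b :* q) refl (ℕtoℚ i) (ℕtoℚ d) q ⟩
    ℕtoℚ d ℚ.* q                                               ≡⟨ total d q≡ ⟩
    ℕtoℚ (∑ (downFrom d) (λ t → g (i + t)))                    ∎
    where
    open ≡-Reasoning
    open +-*-Solver
    total : ∀ d → (∀ {t} → t < d → q ≡ ℕtoℚ (g (i + t))) → ℕtoℚ d ℚ.* q ≡ ℕtoℚ (∑ (downFrom d) (λ t → g (i + t)))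
    total zero    q≡ = ℚ.*-zeroˡ q
    total (suc d) q≡ = begin
      ℕtoℚ (1 + d) ℚ.* q                ≡⟨ cong (ℚ._* q) (ℕtoℚ-+ 1 d) ⟩
      (1ℚ ℚ.+ ℕtoℚ d) ℚ.* q
        ≡⟨ solve 2 (λ a q → (con 1ℚ :+ a) :* q := q :+ a :* q) refl (ℕtoℚ d) q ⟩
      q ℚ.+ ℕtoℚ d ℚ.* q                ≡⟨ cong₂ ℚ._+_ (q≡ ≤-refl) (total d (q≡ ∘ m<n⇒m<1+n)) ⟩
      ℕtoℚ (g (i + d)) ℚ.+ ℕtoℚ (∑ (downFrom d) (λ t → g (i + t))) ≡⟨ ℕtoℚ-+ (g (i + d)) _ ⟨
      ℕtoℚ (∑ (downFrom (suc d)) (λ t → g (i + t))) ∎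

  -- The grid sum below `i` is added on the left so that the right side stays fixed along the
  -- induction. The sorted list may repeat a point, which yields a gap of width 0.
  pieceSum-grid : ∀ i is → Linked _≤_ (i ∷ is) → (∀ {b} → b ∈ i ∷ is → b ∈ bs) → (∀ {b} → b ∈ bs → b ≤ i ⊎ b ∈ is) → M ∈ i ∷ is →
    pieceSum f (map (λ j → frac j M) (i ∷ is)) ℚ.* ℕtoℚ M ℚ.+ ℕtoℚ (∑ (downFrom i) g) ≡ ℕtoℚ (∑ (downFrom M) g)
  pieceSum-grid i [] _ _ _ (here refl) = trans (cong (ℚ._+ ℕtoℚ (∑ (downFrom M) g)) (ℚ.*-zeroˡ (ℕtoℚ M))) (ℚ.+-identityˡ _)
  pieceSum-grid i (j ∷ is) (i≤j ∷ sorted) ⊆bs split M∈ = begin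
    (P ℚ.+ Q) ℚ.* m ℚ.+ S
      ≡⟨ solve 4 (λ P Q m S → (P :+ Q) :* m :+ S := Q :* m :+ (S :+ P :* m)) refl P Q m S ⟩
    Q ℚ.* m ℚ.+ (S ℚ.+ P ℚ.* m)                 ≡⟨ cong (λ l → Q ℚ.* m ℚ.+ (S ℚ.+ l)) P≡ ⟩
    Q ℚ.* m ℚ.+ (S ℚ.+ ℕtoℚ (∑ (downFrom (j ∸ i)) (λ t → g (i + t))))
      ≡⟨ cong (Q ℚ.* m ℚ.+_) (ℕtoℚ-+ (∑ (downFrom i) g) _) ⟨
    Q ℚ.* m ℚ.+ ℕtoℚ (∑ (downFrom i) g + ∑ (downFrom (j ∸ i)) (λ t → g (i + t)))
      ≡⟨ cong (λ l → Q ℚ.* m ℚ.+ ℕtoℚ l) (∑-downFrom-+ i (j ∸ i) g) ⟨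
    Q ℚ.* m ℚ.+ ℕtoℚ (∑ (downFrom (i + (j ∸ i))) g)
      ≡⟨ cong (λ l → Q ℚ.* m ℚ.+ ℕtoℚ (∑ (downFrom l) g)) i+d≡j ⟩
    Q ℚ.* m ℚ.+ ℕtoℚ (∑ (downFrom j) g)         ≡⟨ pieceSum-grid j is sorted (⊆bs ∘ there) split′ (M∈′ M∈) ⟩
    ℕtoℚ (∑ (downFrom M) g)                     ∎
    where
    open ≡-Reasoning
    open +-*-Solver
    mid = (frac i M ℚ.+ frac j M) ℚ.* ½
    P = (frac j M ℚ.- frac i M) ℚ.* f mid
    Q = pieceSum f (map (λ j → frac j M) (j ∷ is))
    m = ℕtoℚ M
    S = ℕtoℚ (∑ (downFrom i) g)
    i+d≡j : i + (j ∸ i) ≡ j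
    i+d≡j = m+[n∸m]≡n i≤j
    j≤ : ∀ {b} → b ∈ j ∷ is → j ≤ b
    j≤ (here refl) = ≤-refl
    j≤ (there b∈)  = All.lookup (Linked.Linked⇒All ≤-trans ≤-refl sorted) (there b∈)
    gap : ∀ {b} → b ∈ bs → b ≤ i ⊎ j ≤ b
    gap b∈ with split b∈
    ... | inj₁ b≤i = inj₁ b≤i
    ... | inj₂ b∈′ = inj₂ (j≤ b∈′)
    split′ : ∀ {b} → b ∈ bs → b ≤ j ⊎ b ∈ is
    split′ b∈ with split b∈
    ... | inj₁ b≤i          = inj₁ (≤-trans b≤i i≤j)
    ... | inj₂ (here refl)  = inj₁ ≤-refl
    ... | inj₂ (there b∈is) = inj₂ b∈is
    M∈′ : M ∈ i ∷ j ∷ is → M ∈ j ∷ is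
    -- If `M` is the head, the next point lies between `M` and the upper bound `M`, so `M` remains
    -- in the tail.
    M∈′ (here refl) = here (≤-antisym i≤j (bs≤M (⊆bs (there (here refl)))))
    M∈′ (there M∈)  = M∈
    P≡ : P ℚ.* m ≡ ℕtoℚ (∑ (downFrom (j ∸ i)) (λ t → g (i + t)))
    P≡ = trans (cong (λ l → (frac l M ℚ.- frac i M) ℚ.* f mid ℚ.* m) (sym i+d≡j)) (piece i (j ∸ i) (f mid)
      λ {t} t<d → trans (cong f (midpoint i j)) (constant gap (m≤m+n i t) (≤-trans (+-monoʳ-< i t<d) (≤-reflexive i+d≡j)) (bs≤M (⊆bs (there (here refl))))))

breakpoints⁻ : ∀ n .{{_ : NonZero n}} {X q} → q ∈ breakpoints n X →
  q ≡ 0ℚ ⊎ q ≡ 1ℚ ⊎ ∃[ y ] ∃[ j ] (suc y ∈ X × j ≤ n * suc y × q ≡ frac j (n * suc y) {{m*n≢0 n (suc y)}})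
breakpoints⁻ (suc ν) (here refl)         = inj₁ refl
breakpoints⁻ (suc ν) (there (here refl)) = inj₂ (inj₁ refl)
breakpoints⁻ n@(suc ν) {X} (there (there q∈)) with find (∈-concatMap⁻ _ {xs = X} q∈)
... | suc y , y∈ , q∈′ with ∈-applyUpTo⁻ (λ j → frac j (n * suc y)) q∈′
...   | j , j< , refl = inj₂ (inj₂ (y , j , y∈ , ≤-pred j< , refl))

breakpoints⁺ : ∀ n .{{_ : NonZero n}} {X y j} → suc y ∈ X → j ≤ n * suc y → frac j (n * suc y) {{m*n≢0 n (suc y)}} ∈ breakpoints n X
breakpoints⁺ n@(suc ν) {X} {y} y∈ j≤ = there (there (∈-concatMap⁺ _ {xs = X} (lose y∈ (∈-applyUpTo⁺ (λ j → frac j (n * suc y)) (s≤s j≤)))))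

0∈breakpoints : ∀ n .{{_ : NonZero n}} X → 0ℚ ∈ breakpoints n X
0∈breakpoints (suc ν) X = here refl

1∈breakpoints : ∀ n .{{_ : NonZero n}} X → 1ℚ ∈ breakpoints n X
1∈breakpoints (suc ν) X = there (here refl)

∣-scale : ∀ {v M j} → v ∣ M → j ≤ v → .{{_ : NonZero v}} → ∃[ i ] (i ≤ M × i * v ≡ j * M)
∣-scale {v} {_} {j} (divides w refl) j≤v = j * w ,
  ≤-trans (*-monoˡ-≤ w j≤v) (≤-reflexive (*-comm v w)) , *-assoc j w v

All-map : ∀ {P : Pred ℕ p} (f : ℕ → ℚ) {qs} → (∀ {q} → q ∈ qs → ∃[ i ] (P i × q ≡ f i)) → ∃[ is ] (qs ≡ map f is × All P is)
All-map f {[]}     h = [] , refl , []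
All-map f {q ∷ qs} h with h (here refl) | All-map f (h ∘ there)
... | i , Pi , refl | is , refl , Pis = i ∷ is , refl , Pi ∷ Pis

-- No multiple of 2 M / v lies strictly between 2 i and 2 j, so ⌊ v s / 2 M ⌋ is
-- constant for 2 i < s < 2 j.
floor-gap : ∀ v M .{{_ : NonZero (2 * M)}} {i j s s′} → v ∣ M → (∀ t → t ≤ v → ∀ b → b * v ≡ t * M → b ≤ i ⊎ j ≤ b) → j ≤ M →
  2 * i < s → s′ < 2 * j → v * s′ / (2 * M) ≤ v * s / (2 * M)
floor-gap zero      M v∣M gap j≤M i<s s′<j = ≤-reflexive refl
floor-gap v@(suc _) .(w * v) {i} {j} {s} {s′} (divides w refl) gap j≤M i<s s′<j = begin
  t                           ≡⟨ m*n/n≡m t (2 * (w * v)) ⟨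
  t * (2 * (w * v)) / (2 * (w * v)) ≤⟨ /-monoˡ-≤ (2 * (w * v)) (begin
    t * (2 * (w * v))           ≡⟨ lem₁ t w v ⟩
    v * (2 * (t * w))           ≤⟨ *-monoʳ-≤ v (*-monoʳ-≤ 2 tw≤i) ⟩
    v * (2 * i)                 ≤⟨ *-monoʳ-≤ v (<⇒≤ i<s) ⟩
    v * s                       ∎) ⟩
  v * s / (2 * (w * v))       ∎
  where
  open ≤-Reasoning
  t = v * s′ / (2 * (w * v))
  lem₁ : ∀ t w v → t * (2 * (w * v)) ≡ v * (2 * (t * w))
  lem₁ = solve-∀
  2tw≤s′ : 2 * (t * w) ≤ s′
  2tw≤s′ = *-cancelˡ-≤ v (begin
    v * (2 * (t * w))   ≡⟨ lem₁ t w v ⟨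
    t * (2 * (w * v))   ≤⟨ m/n*n≤m (v * s′) (2 * (w * v)) ⟩
    v * s′              ∎)
  tw<j : t * w < j
  tw<j = *-cancelˡ-< 2 (t * w) j (≤-<-trans 2tw≤s′ s′<j)
  t≤v : t ≤ v
  t≤v = <⇒≤ (*-cancelˡ-< w t v (≤-trans (≤-reflexive (cong suc (*-comm w t))) (≤-trans tw<j j≤M)))
  tw≤i : t * w ≤ i
  tw≤i with gap t t≤v (t * w) (*-assoc t w v)
  ... | inj₁ ≤i = ≤i
  ... | inj₂ j≤ = contradiction tw<j (≤⇒≯ j≤)

module _ (n M : ℕ) (X : List ℕ) .{{_ : NonZero n}} .{{_ : NonZero M}} (nx∣M : ∀ {x} → x ∈ X → NonZero x → n * x ∣ M) where

  private
    instance
      2M≢0 : NonZero (2 * M)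
      2M≢0 = m*n≢0 2 M
    pt : ℕ → ℚ
    pt i = frac i M
    f : ℚ → ℚ
    f a = ℕtoℚ (maxload n (realBin n a) X)
    g : ℕ → ℕ
    g l = maxload n (gridBin n M l) X

  breakpoints-onGrid : ∀ {q} → q ∈ breakpoints n X → ∃[ i ] (i ≤ M × q ≡ frac i M)
  breakpoints-onGrid q∈ with breakpoints⁻ n {X} q∈
  ... | inj₁ refl        = 0 , z≤n , frac-≡ {0} {1} {0} {M} refl
  ... | inj₂ (inj₁ refl) = M , ≤-refl , frac-≡ {1} {1} {M} {M} (*-comm 1 M)
  ... | inj₂ (inj₂ (y , j , y∈ , j≤ , refl)) with ∣-scale (nx∣M y∈ _) j≤ {{m*n≢0 n (suc y)}}
  ...   | i , i≤M , eq = i , i≤M , frac-≡ {j} {n * suc y} {i} {M} {{m*n≢0 n (suc y)}} (sym eq)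

  expReal-sorted : ∀ {bs} → sort (breakpoints n X) ≡ map pt bs → All (_≤ M) bs →
    expReal n X ℚ.* ℕtoℚ M ≡ ℕtoℚ (∑ (downFrom M) g)
  expReal-sorted {bs} sort≡ bs≤M = grid sort≡ sorted 0∈ id id
    where
    ∈bs : ∀ {i} → pt i ∈ breakpoints n X → i ∈ bs
    ∈bs {i} i∈ with ∈-map⁻ pt (subst (pt i ∈_) sort≡ (∈-resp-↭ (↭-sym (sort-↭ (breakpoints n X))) i∈))
    ... | i′ , i′∈ , eq = subst (_∈ bs) (sym (frac-injective {i} {i′} M eq)) i′∈
    0∈ : 0 ∈ bs
    0∈ = ∈bs (subst (_∈ breakpoints n X) (frac-≡ {0} {1} {0} {M} refl) (0∈breakpoints n X))
    M∈ : M ∈ bs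
    M∈ = ∈bs (subst (_∈ breakpoints n X) (frac-≡ {1} {1} {M} {M} (*-comm 1 M)) (1∈breakpoints n X))
    sorted : Linked _≤_ bs
    sorted = Linked.map (λ {i} {j} le → *-cancelʳ-≤ i j M (frac-cancel-≤ {i} {M} {j} {M} le))
      (Linked.map⁻ (subst (Linked ℚ._≤_) sort≡ (sort-↗ (breakpoints n X))))
    -- In units of `1 / 2 M`, both the midpoint `i + j` of the gap and the grid midpoint
    -- `suc (2 * l)` lie strictly between `2 * i` and `2 * j`, so `floor-gap` applies in both
    -- directions.
    constant : ∀ {i j l} → (∀ {b} → b ∈ bs → b ≤ i ⊎ j ≤ b) → i ≤ l → l < j → j ≤ M → f (frac (i + j) (2 * M)) ≡ ℕtoℚ (g l)
    constant {i} {j} {l} gap i≤l l<j j≤M = cong ℕtoℚ (maxload-cong n X λ {x} x∈ →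
      trans (realBin-frac n (i + j) (2 * M) x) (cong (_% n) (floors x x∈)))
      where
      lem : ∀ i → 2 * i ≡ i + i
      lem = solve-∀
      lem′ : ∀ i → suc (suc (2 * i)) ≡ 2 * suc i
      lem′ = solve-∀
      2i< : 2 * i < i + j
      2i< = ≤-trans (≤-reflexive (cong suc (lem i))) (+-monoʳ-< i (≤-<-trans i≤l l<j))
      <2j : i + j < 2 * j
      <2j = ≤-trans (+-monoˡ-< j (≤-<-trans i≤l l<j)) (≤-reflexive (sym (lem j)))
      2i<′ : 2 * i < suc (2 * l)
      2i<′ = s≤s (*-monoʳ-≤ 2 i≤l)
      <2j′ : suc (2 * l) < 2 * j
      <2j′ = ≤-trans (≤-reflexive (lem′ l)) (*-monoʳ-≤ 2 l<j)
      floors : ∀ x → x ∈ X → n * x * (i + j) / (2 * M) ≡ n * x * suc (2 * l) / (2 * M)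
      floors zero    x∈ = trans (cong (λ v → v * (i + j) / (2 * M)) (*-zeroʳ n)) (sym (cong (λ v → v * suc (2 * l) / (2 * M)) (*-zeroʳ n)))
      floors (suc y) x∈ = ≤-antisym (floor-gap v M v∣M gap′ j≤M 2i<′ <2j) (floor-gap v M v∣M gap′ j≤M 2i< <2j′)
        where
        v = n * suc y
        v∣M = nx∣M x∈ _
        gap′ : ∀ t → t ≤ v → ∀ b → b * v ≡ t * M → b ≤ i ⊎ j ≤ b
        gap′ t t≤v b eq = gap (∈bs (subst (_∈ breakpoints n X) (frac-≡ {t} {v} {b} {M} {{m*n≢0 n (suc y)}} (sym eq)) (breakpoints⁺ n x∈ t≤v)))
    open Grid M f g bs (All.lookup bs≤M) M∈ constant
    -- The list is generalised from `bs` to `is`, so that its head can be matched while `Grid` stays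
    -- instantiated at `bs`.
    grid : ∀ {is} → sort (breakpoints n X) ≡ map pt is → Linked _≤_ is → 0 ∈ is → (∀ {b} → b ∈ is → b ∈ bs) → (∀ {b} → b ∈ bs → b ∈ is) →
      expReal n X ℚ.* ℕtoℚ M ≡ ℕtoℚ (∑ (downFrom M) g)
    grid {i ∷ is} eq sorted 0∈ ⊆bs ⊇bs = begin
      pieceSum f (sort (breakpoints n X)) ℚ.* ℕtoℚ M   ≡⟨ cong (λ l → pieceSum f l ℚ.* ℕtoℚ M) eq ⟩
      pieceSum f (map pt (i ∷ is)) ℚ.* ℕtoℚ M          ≡⟨ ℚ.+-identityʳ _ ⟨
      pieceSum f (map pt (i ∷ is)) ℚ.* ℕtoℚ M ℚ.+ 0ℚ
        ≡⟨ cong (λ l → pieceSum f (map pt (i ∷ is)) ℚ.* ℕtoℚ M ℚ.+ ℕtoℚ (∑ (downFrom l) g)) i≡0 ⟨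
      pieceSum f (map pt (i ∷ is)) ℚ.* ℕtoℚ M ℚ.+ ℕtoℚ (∑ (downFrom i) g)
                                                       ≡⟨ pieceSum-grid i is sorted ⊆bs split (⊇bs M∈) ⟩
      ℕtoℚ (∑ (downFrom M) g)                          ∎
      where
      open ≡-Reasoning
      i≡0 : i ≡ 0
      i≡0 = n≤0⇒n≡0 (All.lookup (Linked.Linked⇒All ≤-trans ≤-refl sorted) 0∈)
      head-or-tail : ∀ {b} → b ∈ i ∷ is → b ≤ i ⊎ b ∈ is
      head-or-tail (here refl) = inj₁ ≤-refl
      head-or-tail (there b∈)  = inj₂ b∈
      split : ∀ {b} → b ∈ bs → b ≤ i ⊎ b ∈ is
      split = head-or-tail ∘ ⊇bs

  -- The breakpoints have denominators `n * x`. Any common multiple `M` of these turns the integral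
  -- into an average of `M` values, and it can be chosen to suit the fractions at hand.
  expReal-grid : expReal n X ℚ.* ℕtoℚ M ≡ ℕtoℚ (∑ (downFrom M) g)
  expReal-grid = expReal-sorted (proj₁ (proj₂ points)) (proj₂ (proj₂ points))
    where
    points = All-map {P = _≤ M} pt (λ q∈ → breakpoints-onGrid (∈-resp-↭ (sort-↭ (breakpoints n X)) q∈))

-- Subsets of an initial segment and cells of the grid

length-unique-⊆ : ∀ {xs ys : List A} → Unique xs → (∀ {x} → x ∈ xs → x ∈ ys) → length xs ≤ length ys
length-unique-⊆ {xs = xs} {ys} uniq sub = subst₂ _≤_ (one xs) (one ys) (∑-unique-⊆ (λ _ → 1) uniq sub)
  where
  one : ∀ zs → ∑ zs (λ _ → 1) ≡ length zs
  one zs = trans (∑-const zs 1) (*-identityʳ (length zs))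

subsetsOfSize-< : ∀ n k {X x} → X ∈ subsetsOfSize n k → x ∈ X → x < k
subsetsOfSize-< zero    k       (here refl) ()
subsetsOfSize-< (suc n) (suc k) X∈ x∈ with ∈-++⁻ (subsetsOfSize (suc n) k) X∈
... | inj₁ X∈′ = m<n⇒m<1+n (subsetsOfSize-< (suc n) k X∈′ x∈)
... | inj₂ X∈′ with ∈-map⁻ (k ∷_) X∈′
...   | Y , Y∈ , refl with x∈
...     | here refl = ≤-refl
...     | there x∈Y = m<n⇒m<1+n (subsetsOfSize-< n k Y∈ x∈Y)

subsetsOfSize-mono : ∀ n {k l X} → k ≤ l → X ∈ subsetsOfSize n k → X ∈ subsetsOfSize n l
subsetsOfSize-mono zero    _ X∈ = X∈
subsetsOfSize-mono (suc n) {k} {zero}  z≤n ()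
subsetsOfSize-mono (suc n) {k} {suc l} k≤l X∈ with m≤n⇒m<n∨m≡n k≤l
... | inj₁ k<l  = ∈-++⁺ˡ (subsetsOfSize-mono (suc n) (≤-pred k<l) X∈)
... | inj₂ refl = X∈

-- Makes `n * u !` a common multiple of the breakpoint denominators `n * x` for `0 < x ≤ u`.
∈⇒∣! : ∀ {x u} .{{_ : NonZero x}} → x ≤ u → x ∣ u !
∈⇒∣! {suc x} x≤u = ∣-trans (m∣m*n (x !)) (m≤n⇒m!∣n! x≤u)

-- On the grid with `M = B * w`, the cell from `i / B` to `(i + 1) / B` consists of `w` grid
-- intervals, and so contains their midpoints.
gridBin-bounds : ∀ B w i t .{{_ : NonZero B}} → t < w →
  suc (2 * (i * w + t)) * B ≤ suc i * (2 * (B * w)) × i * (2 * (B * w)) ≤ suc (2 * (i * w + t)) * B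
gridBin-bounds B w i t t<w =
  ≤-trans (*-monoˡ-≤ B (≤-trans (≤-reflexive (lem₁ i w t)) (≤-trans (+-monoʳ-≤ (2 * (i * w) + t) t<w) (+-monoˡ-≤ w (+-monoʳ-≤ (2 * (i * w)) (<⇒≤ t<w))))))
    (≤-reflexive (lem₂ B w i)) ,
  ≤-trans (m≤m+n _ (suc (2 * t) * B)) (≤-reflexive (lem₃ B w i t))
  where
  lem₁ : ∀ i w t → suc (2 * (i * w + t)) ≡ 2 * (i * w) + t + suc t
  lem₁ = solve-∀
  lem₂ : ∀ B w i → (2 * (i * w) + w + w) * B ≡ suc i * (2 * (B * w))
  lem₂ = solve-∀
  lem₃ : ∀ B w i t → i * (2 * (B * w)) + suc (2 * t) * B ≡ suc (2 * (i * w + t)) * B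
  lem₃ = solve-∀

-- Powers of two as moduli

odd : ℕ → ℕ
odd i = suc (2 * i)

odds : ℕ → List ℕ
odds h = map odd (downFrom h)

odds-unique : ∀ h → Unique (odds h)
odds-unique h = Unique.map⁺ (λ {x} {y} eq → *-cancelˡ-≡ x y 2 (suc-injective eq)) (Unique.downFrom⁺ h)

prime∣2^ : ∀ {q} e → Prime q → q ∣ 2 ^ e → q ≡ 2
prime∣2^ zero    q-prime q∣ = contradiction q-prime (subst (¬_ ∘ Prime) (sym (∣1⇒≡1 q∣)) ¬prime[1])
prime∣2^ (suc e) q-prime q∣ with euclidsLemma 2 (2 ^ e) q-prime q∣
... | inj₂ q∣2^e = prime∣2^ e q-prime q∣2^e
... | inj₁ q∣2 with prime⇒irreducible prime[2] q∣2
...   | inj₁ refl = contradiction q-prime ¬prime[1]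
...   | inj₂ q≡2  = q≡2

2∤odd : ∀ i → 2 ∤ odd i
2∤odd i 2∣ = contradiction (∣1⇒≡1 (∣m+n∣m⇒∣n (subst (2 ∣_) (+-comm 1 (2 * i)) 2∣) (m∣m*n i))) λ ()

even-or-odd : ∀ c → 2 ∣ c ⊎ ∃[ i ] c ≡ odd i
even-or-odd zero    = inj₁ (2 ∣0)
even-or-odd (suc c) with even-or-odd c
... | inj₁ (divides i refl) = inj₂ (i , cong suc (*-comm i 2))
... | inj₂ (i , refl)       = inj₁ (divides (suc i) (cong (suc ∘ suc) (*-comm 2 i)))

∈-units⁺ : ∀ {c k} → c < k → gcd c k ≡ 1 → c ∈ units k
∈-units⁺ {k = k} c<k g≡1 = ∈-filter⁺ (λ c → gcd c k ≟ 1) (∈-upTo⁺ c<k) g≡1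

∈-units⁻ : ∀ {c k} → c ∈ units k → c < k × gcd c k ≡ 1
∈-units⁻ {k = k} c∈ with ∈-filter⁻ (λ c → gcd c k ≟ 1) c∈
... | c∈′ , g≡1 = ∈-upTo⁻ c∈′ , g≡1

units-unique : ∀ k → Unique (units k)
units-unique k = Unique.filter⁺ (λ c → gcd c k ≟ 1) (Unique.upTo⁺ k)

odds⊆units : ∀ e {c} → c ∈ odds (2 ^ e) → c ∈ units (2 ^ suc e)
odds⊆units e c∈ with ∈-map⁻ odd c∈
... | i , i∈ , refl = ∈-units⁺ odd<  coprime
  where
  lem : ∀ i → suc (suc (2 * i)) ≡ 2 * suc i
  lem = solve-∀
  odd< : odd i < 2 ^ suc e
  odd< = ≤-trans (≤-reflexive (lem i)) (*-monoʳ-≤ 2 (∈-downFrom⁻ i∈))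
  coprime : gcd (odd i) (2 ^ suc e) ≡ 1
  coprime with gcd (odd i) (2 ^ suc e) ≟ 1
  ... | yes g≡1 = g≡1
  ... | no g≢1 with ∃-prime-divisor (gcd (odd i) (2 ^ suc e)) (gcd[m,n]≢0 (odd i) (2 ^ suc e) (inj₁ λ ())) g≢1
  ...   | q , q-prime , q∣g with prime∣2^ (suc e) q-prime (∣-trans q∣g (gcd[m,n]∣n (odd i) (2 ^ suc e)))
  ...     | refl = contradiction (∣-trans q∣g (gcd[m,n]∣m (odd i) (2 ^ suc e))) (2∤odd i)

units⊆odds : ∀ e {c} → c ∈ units (2 ^ suc e) → c ∈ odds (2 ^ e)
units⊆odds e {c} c∈ with ∈-units⁻ {k = 2 ^ suc e} c∈ | even-or-odd c
... | c< , g≡1 | inj₁ 2∣c = contradiction (∣1⇒≡1 (subst (2 ∣_) g≡1 (gcd-greatest 2∣c (m∣m*n (2 ^ e))))) λ ()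
... | c< , g≡1 | inj₂ (i , refl) = ∈-map⁺ odd (∈-downFrom⁺ (*-cancelˡ-< 2 i (2 ^ e) (<-trans ≤-refl c<)))

length-units-2^ : ∀ e → length (units (2 ^ suc e)) ≡ 2 ^ e
length-units-2^ e = ≤-antisym
  (≤-trans (length-unique-⊆ (units-unique (2 ^ suc e)) (units⊆odds e)) (≤-reflexive length-odds))
  (≤-trans (≤-reflexive (sym length-odds)) (length-unique-⊆ (odds-unique (2 ^ e)) (odds⊆units e)))
  where
  length-odds : length (odds (2 ^ e)) ≡ 2 ^ e
  length-odds = trans (length-map odd (downFrom (2 ^ e))) (length-downFrom (2 ^ e))

-- The units of 2 h = 2 ^ suc e are the odd numbers, one for each cell [i / h, (i + 1) / h).
expReal≤expSH : ∀ n u e X .{{_ : NonZero n}} → n * u ≤ 4 * 2 ^ e → (∀ {x} → x ∈ X → x ≤ u) →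
  expReal n X ℚ.≤ ℕtoℚ 9 ℚ.* expSH (2 ^ suc e) n X
expReal≤expSH n u e X {{n≢0}} nu≤ X≤ = ℚ.*-cancelʳ-≤-pos (ℕtoℚ M) {{ℕtoℚ-pos M}} (begin
  expReal n X ℚ.* ℕtoℚ M
    ≡⟨ expReal-grid n M X (λ x∈ x≢0 → ∣n⇒∣m*n h (*-monoʳ-∣ n (∈⇒∣! {{x≢0}} (X≤ x∈)))) ⟩
  ℕtoℚ (∑ (downFrom M) real)                       ≤⟨ ℕtoℚ-≤ total ⟩
  ℕtoℚ (9 * S * w)
    ≡⟨ trans (ℕtoℚ-* (9 * S) w) (cong (ℚ._* ℕtoℚ w) (ℕtoℚ-* 9 S)) ⟩
  ℕtoℚ 9 ℚ.* ℕtoℚ S ℚ.* ℕtoℚ w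
    ≡⟨ cong (λ s → ℕtoℚ 9 ℚ.* s ℚ.* ℕtoℚ w) (expSH*length k n X) ⟨
  ℕtoℚ 9 ℚ.* (E ℚ.* ℕtoℚ (length (units k))) ℚ.* ℕtoℚ w
    ≡⟨ cong (λ l → ℕtoℚ 9 ℚ.* (E ℚ.* ℕtoℚ l) ℚ.* ℕtoℚ w) (length-units-2^ e) ⟩
  ℕtoℚ 9 ℚ.* (E ℚ.* ℕtoℚ h) ℚ.* ℕtoℚ w
    ≡⟨ solve 4 (λ a E h w → a :* (E :* h) :* w := a :* E :* (h :* w)) refl (ℕtoℚ 9) E (ℕtoℚ h) (ℕtoℚ w) ⟩
  ℕtoℚ 9 ℚ.* E ℚ.* (ℕtoℚ h ℚ.* ℕtoℚ w)             ≡⟨ cong (ℕtoℚ 9 ℚ.* E ℚ.*_) (ℕtoℚ-* h w) ⟨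
  ℕtoℚ 9 ℚ.* E ℚ.* ℕtoℚ M                          ∎)
  where
  open ℚ.≤-Reasoning
  open +-*-Solver using (solve; _:*_; _:=_)
  h = 2 ^ e
  k = 2 ^ suc e
  -- The number of grid intervals per cell; it makes `M` divisible by every `n * x`.
  w = n * u !
  M = h * w
  instance
    h≢0 : NonZero h
    h≢0 = m^n≢0 2 e
    k≢0 : NonZero k
    k≢0 = m^n≢0 2 (suc e)
    M≢0 : NonZero M
    M≢0 = m*n≢0 h w {{m^n≢0 2 e}} {{m*n≢0 n (u !) {{n≢0}} {{u !≢0}}}}
  E = expSH k n X
  real sh : ℕ → ℕ
  real l = maxload n (gridBin n M l) X
  sh c = maxload n (shBin n k c) X
  S = ∑ (units k) sh
  near : ∀ i {t} → t ∈ downFrom w → real (i * w + t) ≤ 9 * sh (odd i)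
  -- The fraction `odd i / 2 h` is the midpoint of its cell. Since `n * x ≤ n * u ≤ 4 * h`, floors
  -- differ by at most 4, and `9 = 2 * 4 + 1`.
  near i {t} t∈ = proj₁ (maxload-close n M k (odd i) (i * w + t) h i 4 X
    (λ x∈ → ≤-trans (*-monoʳ-≤ n (X≤ x∈)) nu≤)
    (≤-trans (m≤m+n _ h) (≤-reflexive (lem₁ i h))) (≤-trans (m≤m+n _ h) (≤-reflexive (lem₂ i h)))
    (proj₁ bounds) (proj₂ bounds))
    where
    bounds = gridBin-bounds h w i t (∈-downFrom⁻ t∈)
    lem₁ : ∀ i h → suc (2 * i) * h + h ≡ suc i * (2 * h)
    lem₁ = solve-∀
    lem₂ : ∀ i h → i * (2 * h) + h ≡ suc (2 * i) * h
    lem₂ = solve-∀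
  total : ∑ (downFrom M) real ≤ 9 * S * w
  total = ≤-trans (≤-reflexive (∑-downFrom-* h w real))
    (≤-trans (∑-mono (downFrom h) (λ {i} _ → ≤-trans (∑-mono (downFrom w) (near i)) (≤-reflexive (∑-const (downFrom w) (9 * sh (odd i))))))
    (≤-trans (≤-reflexive (trans (∑-cong (downFrom h) (λ {i} _ → trans (cong (_* (9 * sh (odd i))) (length-downFrom w)) (lem w (sh (odd i)))))
      (trans (∑-*ˡ (downFrom h) (9 * w) (sh ∘ odd)) (cong (9 * w *_) (sym (∑-map (downFrom h) odd sh))))))
    (≤-trans (*-monoʳ-≤ (9 * w) (∑-unique-⊆ sh (odds-unique h) (odds⊆units e))) (≤-reflexive (lem′ w S)))))
    where
    lem : ∀ w s → w * (9 * s) ≡ 9 * w * s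
    lem = solve-∀
    lem′ : ∀ w S → 9 * w * S ≡ 9 * S * w
    lem′ = solve-∀

-- Reduced fractions with bounded denominators and their cells

map-unique : ∀ (f : A → B) {xs} → Unique xs → (∀ {x y} → x ∈ xs → y ∈ xs → f x ≡ f y → x ≡ y) → Unique (map f xs)
map-unique f {[]}     []          inj = []
map-unique f {x ∷ xs} (x∉ ∷ uniq) inj =
  All.map⁺ (All.tabulate λ y∈ fx≡fy → All.lookup x∉ y∈ (inj (here refl) (there y∈) fx≡fy)) ∷
  map-unique f uniq λ x∈ y∈ → inj (there x∈) (there y∈)

concatMap-unique : ∀ (f : A → List B) {xs} → Unique xs → (∀ {x} → x ∈ xs → Unique (f x)) →
  (∀ {x y z} → x ∈ xs → y ∈ xs → z ∈ f x → z ∈ f y → x ≡ y) → Unique (concatMap f xs)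
concatMap-unique f {[]}     []          uniqs inj = []
concatMap-unique f {x ∷ xs} (x∉ ∷ uniq) uniqs inj =
  Unique.++⁺ (uniqs (here refl)) (concatMap-unique f uniq (uniqs ∘ there) λ x∈ y∈ → inj (there x∈) (there y∈)) disjoint
  where
  disjoint : ∀ {z} → ¬ (z ∈ f x × z ∈ concatMap f xs)
  disjoint (z∈ , z∈′) with find (∈-concatMap⁻ f {xs = xs} z∈′)
  ... | y , y∈ , z∈fy = All.lookup x∉ y∈ (inj (here refl) (there y∈) z∈ z∈fy)

/₀-bounds : ∀ a k .{{_ : NonZero k}} → a /₀ k * k ≤ a × a < suc (a /₀ k) * k
/₀-bounds a k@(suc _) = m/n*n≤m a k ,
  ≤-trans (≤-reflexive (cong suc (trans (m≡m%n+[m/n]*n a k) (+-comm (a % k) (a / k * k))))) (≤-trans (+-monoʳ-< (a / k * k) (m%n<n a k)) (≤-reflexive (+-comm (a / k * k) k)))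

-- The index β of the cell [β / m ^ 2, (β + 1) / m ^ 2) containing c / k.
cell : ℕ → ℕ → ℕ → ℕ
cell m k c = (c * (m * m)) /₀ k

cell-< : ∀ m k c .{{_ : NonZero k}} .{{_ : NonZero (m * m)}} → c < k → cell m k c < m * m
cell-< m k c c<k = *-cancelʳ-< k (cell m k c) (m * m) (begin-strict
  cell m k c * k   ≤⟨ proj₁ (/₀-bounds (c * (m * m)) k) ⟩
  c * (m * m)      <⟨ *-monoˡ-< (m * m) c<k ⟩
  k * (m * m)      ≡⟨ *-comm k (m * m) ⟩
  m * m * k        ∎)
  where open ≤-Reasoning

-- Otherwise the fractions would differ by at least 1 / (k k′) ≥ 1 / m ^ 2.
cell-separated : ∀ m {k k′ c c′} .{{_ : NonZero k}} .{{_ : NonZero k′}} → k ≤ m → k′ ≤ m →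
  cell m k c ≡ cell m k′ c′ → c′ * k ≤ c * k′
cell-separated m {k} {k′} {c} {c′} k≤m k′≤m eq = ≮⇒≥ λ ck′<c′k → <-irrefl refl (begin-strict
  q * (k * k′) + N
    ≤⟨ +-monoˡ-≤ N (≤-trans (≤-reflexive (sym (*-assoc q k k′))) (*-monoˡ-≤ k′ (proj₁ (/₀-bounds (c * N) k)))) ⟩
  c * N * k′ + N                ≡⟨ lem₁ c N k′ ⟩
  suc (c * k′) * N              ≤⟨ *-monoˡ-≤ N ck′<c′k ⟩
  c′ * k * N                    ≡⟨ lem₂ c′ k N ⟩
  c′ * N * k                    <⟨ *-monoˡ-< k (proj₂ (/₀-bounds (c′ * N) k′)) ⟩
  suc (cell m k′ c′) * k′ * k   ≡⟨ cong (λ l → suc l * k′ * k) eq ⟨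
  suc q * k′ * k                ≡⟨ lem₃ q k k′ ⟩
  q * (k * k′) + k * k′         ≤⟨ +-monoʳ-≤ (q * (k * k′)) (*-mono-≤ k≤m k′≤m) ⟩
  q * (k * k′) + N              ∎)
  where
  open ≤-Reasoning
  N = m * m
  q = cell m k c
  lem₁ : ∀ c N k → c * N * k + N ≡ suc (c * k) * N
  lem₁ = solve-∀
  lem₂ : ∀ c k N → c * k * N ≡ c * N * k
  lem₂ = solve-∀
  lem₃ : ∀ q k l → suc q * l * k ≡ q * (k * l) + k * l
  lem₃ = solve-∀

-- Each denominator divides the other: `k` divides `c * k′` and is coprime to `c`, and
-- symmetrically.
reduced-unique : ∀ {k k′ c c′} → gcd c k ≡ 1 → gcd c′ k′ ≡ 1 → c * k′ ≡ c′ * k → k ≡ k′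
reduced-unique {k} {k′} {c} {c′} g g′ eq = ∣-antisym
  (coprime-divisor {k} {c} (Coprime.sym (gcd≡1⇒coprime {c} {k} g)) (subst (k ∣_) (sym eq) (n∣m*n c′)))
  (coprime-divisor {k′} {c′} (Coprime.sym (gcd≡1⇒coprime {c′} {k′} g′)) (subst (k′ ∣_) eq (n∣m*n c)))

module _ (m : ℕ) .{{_ : NonZero m}} where

  halfRange-bounds : ∀ {k} → k ∈ halfRange m → k ≤ m × m ≤ 2 * k
  halfRange-bounds k∈ with ∈-filter⁻ (λ k → m ≤? 2 * k) {xs = upTo (suc m)} k∈
  ... | k∈′ , m≤2k = ≤-pred (∈-upTo⁻ k∈′) , m≤2k

  halfRange-nonZero : ∀ {k} → k ∈ halfRange m → NonZero k
  halfRange-nonZero {zero}  k∈ = contradiction (proj₂ (halfRange-bounds k∈)) (<⇒≱ (>-nonZero⁻¹ m))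
  halfRange-nonZero {suc _} k∈ = _

  halfRange-unique : Unique (halfRange m)
  halfRange-unique = Unique.filter⁺ (λ k → m ≤? 2 * k) (Unique.upTo⁺ (suc m))

  -- The range contains `⌈ m /2⌉ + i` for all `i` from 0 to `⌊ m /2⌋`.
  m≤2*length-halfRange : m ≤ 2 * length (halfRange m)
  m≤2*length-halfRange = begin
    m                                    ≡⟨ ⌊n/2⌋+⌈n/2⌉≡n m ⟨
    ⌊ m /2⌋ + ⌈ m /2⌉                    ≤⟨ +-mono-≤ (n≤1+n ⌊ m /2⌋) (⌊n/2⌋-mono (n≤1+n (suc m))) ⟩
    suc ⌊ m /2⌋ + suc ⌊ m /2⌋            ≡⟨ cong (suc ⌊ m /2⌋ +_) (+-identityʳ (suc ⌊ m /2⌋)) ⟨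
    2 * suc ⌊ m /2⌋
      ≡⟨ cong (2 *_) (trans (length-map (λ i → ⌈ m /2⌉ + i) (downFrom (suc ⌊ m /2⌋))) (length-downFrom (suc ⌊ m /2⌋))) ⟨
    2 * length (map (λ i → ⌈ m /2⌉ + i) (downFrom (suc ⌊ m /2⌋)))
      ≤⟨ *-monoʳ-≤ 2 (length-unique-⊆ (Unique.map⁺ (λ {i} {j} → +-cancelˡ-≡ ⌈ m /2⌉ i j) (Unique.downFrom⁺ (suc ⌊ m /2⌋))) upper-half) ⟩
    2 * length (halfRange m)             ∎
    where
    open ≤-Reasoning
    m≤2⌈⌉ : m ≤ 2 * ⌈ m /2⌉
    m≤2⌈⌉ = begin
      m                       ≡⟨ ⌊n/2⌋+⌈n/2⌉≡n m ⟨
      ⌊ m /2⌋ + ⌈ m /2⌉       ≤⟨ +-monoˡ-≤ ⌈ m /2⌉ (⌊n/2⌋≤⌈n/2⌉ m) ⟩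
      ⌈ m /2⌉ + ⌈ m /2⌉       ≡⟨ cong (λ i → ⌈ m /2⌉ + i) (+-identityʳ ⌈ m /2⌉) ⟨
      2 * ⌈ m /2⌉             ∎
    upper-half : ∀ {k} → k ∈ map (λ i → ⌈ m /2⌉ + i) (downFrom (suc ⌊ m /2⌋)) → k ∈ halfRange m
    upper-half k∈ with ∈-map⁻ (λ i → ⌈ m /2⌉ + i) k∈
    ... | i , i∈ , refl = ∈-filter⁺ (λ k → m ≤? 2 * k)
      (∈-upTo⁺ (s≤s (≤-trans (+-monoʳ-≤ ⌈ m /2⌉ (≤-pred (∈-downFrom⁻ i∈))) (≤-reflexive (trans (+-comm ⌈ m /2⌉ ⌊ m /2⌋) (⌊n/2⌋+⌈n/2⌉≡n m))))))
      (≤-trans m≤2⌈⌉ (*-monoʳ-≤ 2 (m≤m+n ⌈ m /2⌉ i)))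

  cells : List ℕ
  cells = concatMap (λ k → map (cell m k) (units k)) (halfRange m)

  -- Separation applied in both orders shows that a shared cell forces equal fractions; lowest terms
  -- then give equal moduli, and equal moduli give equal multipliers.
  cells-unique : Unique cells
  cells-unique = concatMap-unique (λ k → map (cell m k) (units k)) halfRange-unique
    (λ {k} k∈ → map-unique (cell m k) (units-unique k) (same-modulus k∈))
    same-cell
    where
    cross : ∀ {k k′ c c′} → k ∈ halfRange m → k′ ∈ halfRange m → cell m k c ≡ cell m k′ c′ → c * k′ ≡ c′ * k
    cross {k} {k′} {c} {c′} k∈ k′∈ eq = ≤-antisym
      (cell-separated m {k′} {k} {c′} {c} {{halfRange-nonZero k′∈}} {{halfRange-nonZero k∈}} (proj₁ (halfRange-bounds k′∈)) (proj₁ (halfRange-bounds k∈)) (sym eq))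
      (cell-separated m {k} {k′} {c} {c′} {{halfRange-nonZero k∈}} {{halfRange-nonZero k′∈}} (proj₁ (halfRange-bounds k∈)) (proj₁ (halfRange-bounds k′∈)) eq)
    same-modulus : ∀ {k c c′} → k ∈ halfRange m → c ∈ units k → c′ ∈ units k → cell m k c ≡ cell m k c′ → c ≡ c′
    same-modulus {k} {c} {c′} k∈ _ _ eq = *-cancelʳ-≡ c c′ k {{halfRange-nonZero k∈}} (cross {k} {k} {c} {c′} k∈ k∈ eq)
    same-cell : ∀ {k k′ z} → k ∈ halfRange m → k′ ∈ halfRange m → z ∈ map (cell m k) (units k) → z ∈ map (cell m k′) (units k′) → k ≡ k′
    same-cell {k} {k′} k∈ k′∈ z∈ z∈′ with ∈-map⁻ (cell m k) z∈ | ∈-map⁻ (cell m k′) z∈′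
    ... | c , c∈ , refl | c′ , c′∈ , eq = reduced-unique {k} {k′} {c} {c′} (proj₂ (∈-units⁻ {c} {k} c∈)) (proj₂ (∈-units⁻ {c′} {k′} c′∈)) (cross {k} {k′} {c} {c′} k∈ k′∈ eq)

  cells-< : ∀ {z} → z ∈ cells → z ∈ downFrom (m * m)
  cells-< z∈ with find (∈-concatMap⁻ (λ k → map (cell m k) (units k)) {xs = halfRange m} z∈)
  ... | k , k∈ , z∈′ with ∈-map⁻ (cell m k) z∈′
  ...   | c , c∈ , refl = ∈-downFrom⁺ (cell-< m k c {{halfRange-nonZero k∈}} {{m*n≢0 m m}} (proj₁ (∈-units⁻ {c} {k} c∈)))

  -- Every pair of a modulus and a unit owns a cell with `w` grid points. Since `n * x ≤ m * m`,
  -- floors within a cell differ by at most 1, whence the factor `3 = 2 * 1 + 1`; as no cell is used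
  -- twice, the sum over owned cells is at most the whole grid sum.
  ∑-SH≤∑-grid : ∀ n w X .{{_ : NonZero n}} .{{_ : NonZero (m * m * w)}} → n ≤ m → (∀ {x} → x ∈ X → x ≤ m) →
    w * ∑ (halfRange m) (λ k → ∑ (units k) (λ c → maxload n (shBin n k c) X)) ≤
    3 * ∑ (downFrom (m * m * w)) (λ l → maxload n (gridBin n (m * m * w) l) X)
  ∑-SH≤∑-grid n w X n≤m X≤m = begin
    w * ∑ (halfRange m) (λ k → ∑ (units k) (sh k))
      ≡⟨ ∑-*ˡ (halfRange m) w (λ k → ∑ (units k) (sh k)) ⟨
    ∑ (halfRange m) (λ k → w * ∑ (units k) (sh k))
      ≡⟨ ∑-cong (halfRange m) (λ {k} _ → sym (∑-*ˡ (units k) w (sh k))) ⟩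
    ∑ (halfRange m) (λ k → ∑ (units k) (λ c → w * sh k c))
      ≤⟨ ∑-mono (halfRange m) (λ {k} k∈ → ∑-mono (units k) (λ {c} c∈ → block k c k∈ c∈)) ⟩
    ∑ (halfRange m) (λ k → ∑ (units k) (λ c → 3 * inCell (cell m k c)))
      ≡⟨ ∑-cong (halfRange m) (λ {k} _ → trans (∑-*ˡ (units k) 3 _) (cong (3 *_) (sym (∑-map (units k) (cell m k) inCell)))) ⟩
    ∑ (halfRange m) (λ k → 3 * ∑ (map (cell m k) (units k)) inCell)   ≡⟨ ∑-*ˡ (halfRange m) 3 _ ⟩
    3 * ∑ (halfRange m) (λ k → ∑ (map (cell m k) (units k)) inCell)
      ≡⟨ cong (3 *_) (∑-concatMap (halfRange m) (λ k → map (cell m k) (units k)) inCell) ⟨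
    3 * ∑ cells inCell
      ≤⟨ *-monoʳ-≤ 3 (∑-unique-⊆ inCell cells-unique cells-<) ⟩
    3 * ∑ (downFrom (m * m)) inCell
      ≡⟨ cong (3 *_) (∑-downFrom-* (m * m) w real) ⟨
    3 * ∑ (downFrom (m * m * w)) real                                 ∎
    where
    open ≤-Reasoning
    sh : ℕ → ℕ → ℕ
    sh k c = maxload n (shBin n k c) X
    real : ℕ → ℕ
    real l = maxload n (gridBin n (m * m * w) l) X
    inCell : ℕ → ℕ
    inCell z = ∑ (downFrom w) (λ t → real (z * w + t))
    block : ∀ k c → k ∈ halfRange m → c ∈ units k → w * sh k c ≤ 3 * inCell (cell m k c)
    block k c k∈ c∈ = begin
      w * sh k c                         ≡⟨ cong (_* sh k c) (length-downFrom w) ⟨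
      length (downFrom w) * sh k c       ≡⟨ ∑-const (downFrom w) (sh k c) ⟨
      ∑ (downFrom w) (λ _ → sh k c)      ≤⟨ ∑-mono (downFrom w) (λ {t} t∈ → near t (∈-downFrom⁻ t∈)) ⟩
      ∑ (downFrom w) (λ t → 3 * real (z * w + t)) ≡⟨ ∑-*ˡ (downFrom w) 3 _ ⟩
      3 * inCell z                       ∎
      where
      z = cell m k c
      instance
        k≢0 : NonZero k
        k≢0 = halfRange-nonZero k∈
        B≢0 : NonZero (m * m)
        B≢0 = m*n≢0 m m
      near : ∀ t → t < w → sh k c ≤ 3 * real (z * w + t)
      near t t<w = proj₂ (maxload-close n (m * m * w) k c (z * w + t) (m * m) z 1 X
        (λ x∈ → ≤-trans (*-mono-≤ n≤m (X≤m x∈)) (≤-reflexive (sym (*-identityˡ (m * m)))))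
        (<⇒≤ (proj₂ (/₀-bounds (c * (m * m)) k))) (proj₁ (/₀-bounds (c * (m * m)) k))
        (proj₁ (gridBin-bounds (m * m) w z t t<w)) (proj₂ (gridBin-bounds (m * m) w z t t<w)))

-- Random-modulus hashing against real hashing

0≤ℕtoℚ : ∀ i → 0ℚ ℚ.≤ ℕtoℚ i
0≤ℕtoℚ i = ℚ.nonNegative⁻¹ (ℕtoℚ i) {{ℕtoℚ-nonNeg i}}

*-monoˡ-≤-ℕtoℚ : ∀ i {p q} → p ℚ.≤ q → ℕtoℚ i ℚ.* p ℚ.≤ ℕtoℚ i ℚ.* q
*-monoˡ-≤-ℕtoℚ i = ℚ.*-monoˡ-≤-nonNeg (ℕtoℚ i) {{ℕtoℚ-nonNeg i}}

*-cancelʳ-≤-ℕtoℚ : ∀ d .{{_ : NonZero d}} {p q} → p ℚ.* ℕtoℚ d ℚ.≤ q ℚ.* ℕtoℚ d → p ℚ.≤ q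
*-cancelʳ-≤-ℕtoℚ d = ℚ.*-cancelʳ-≤-pos (ℕtoℚ d) {{ℕtoℚ-pos d}}

0≤-cancel : ∀ {q} d .{{_ : NonZero d}} → 0ℚ ℚ.≤ q ℚ.* ℕtoℚ d → 0ℚ ℚ.≤ q
0≤-cancel d le = *-cancelʳ-≤-ℕtoℚ d (ℚ.≤-trans (ℚ.≤-reflexive (ℚ.*-zeroˡ (ℕtoℚ d))) le)

-- For an average `q` of `b` values with sum `r`, a lower bound `a / t` on `b` permits division by
-- `a` at the cost of a factor `t`. It is applied to the number of moduli and to the number of
-- units.
rescale : ∀ {q r a b} t → 0ℚ ℚ.≤ q → q ℚ.* ℕtoℚ b ≡ r → a ≤ t * b → q ℚ.* ℕtoℚ a ℚ.≤ ℕtoℚ t ℚ.* r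
rescale {q} {r} {a} {b} t 0≤q eq a≤ = begin
  q ℚ.* ℕtoℚ a                  ≤⟨ ℚ.*-monoˡ-≤-nonNeg q {{ℚ.nonNegative 0≤q}} (ℕtoℚ-≤ {a} {t * b} a≤) ⟩
  q ℚ.* ℕtoℚ (t * b)            ≡⟨ cong (q ℚ.*_) (ℕtoℚ-* t b) ⟩
  q ℚ.* (ℕtoℚ t ℚ.* ℕtoℚ b)
    ≡⟨ solve 3 (λ q t b → q :* (t :* b) := t :* (q :* b)) refl q (ℕtoℚ t) (ℕtoℚ b) ⟩
  ℕtoℚ t ℚ.* (q ℚ.* ℕtoℚ b)     ≡⟨ cong (ℕtoℚ t ℚ.*_) eq ⟩
  ℕtoℚ t ℚ.* r                  ∎
  where
  open ℚ.≤-Reasoning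
  open +-*-Solver using (solve; _:*_; _:=_)

0≤sumℚ : ∀ (f : A → ℚ) xs → (∀ x → 0ℚ ℚ.≤ f x) → 0ℚ ℚ.≤ sumℚ (map f xs)
0≤sumℚ f []       h = ℚ.≤-refl
0≤sumℚ f (x ∷ xs) h = ℚ.≤-trans (ℚ.≤-reflexive (sym (ℚ.+-identityˡ 0ℚ))) (ℚ.+-mono-≤ (h x) (0≤sumℚ f xs h))

0≤avgℚ : ∀ (f : A → ℚ) xs → (∀ x → 0ℚ ℚ.≤ f x) → 0ℚ ℚ.≤ avgℚ (map f xs)
0≤avgℚ f []       h = ℚ.≤-refl
0≤avgℚ f (x ∷ xs) h = 0≤-cancel (suc (length (map f xs)))
  (ℚ.≤-trans (0≤sumℚ f (x ∷ xs) h) (ℚ.≤-reflexive (sym (avgℚ*length (map f (x ∷ xs))))))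

sumℚ-bound : ∀ (f : A → ℚ) (g : A → ℕ) m xs → (∀ {x} → x ∈ xs → f x ℚ.* ℕtoℚ m ℚ.≤ ℕtoℚ (g x)) →
  sumℚ (map f xs) ℚ.* ℕtoℚ m ℚ.≤ ℕtoℚ (∑ xs g)
sumℚ-bound f g m []       h = ℚ.≤-reflexive (ℚ.*-zeroˡ (ℕtoℚ m))
sumℚ-bound f g m (x ∷ xs) h = begin
  (f x ℚ.+ sumℚ (map f xs)) ℚ.* ℕtoℚ m               ≡⟨ ℚ.*-distribʳ-+ (ℕtoℚ m) (f x) _ ⟩
  f x ℚ.* ℕtoℚ m ℚ.+ sumℚ (map f xs) ℚ.* ℕtoℚ m
    ≤⟨ ℚ.+-mono-≤ (h (here refl)) (sumℚ-bound f g m xs (h ∘ there)) ⟩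
  ℕtoℚ (g x) ℚ.+ ℕtoℚ (∑ xs g)                       ≡⟨ ℕtoℚ-+ (g x) (∑ xs g) ⟨
  ℕtoℚ (g x + ∑ xs g)                                ∎
  where open ℚ.≤-Reasoning

0≤expSH : ∀ k n X → 0ℚ ℚ.≤ expSH k n X
0≤expSH k n X = 0≤avgℚ (λ c → ℕtoℚ (maxload n (shBin n k c) X)) (units k) (λ c → 0≤ℕtoℚ (maxload n (shBin n k c) X))

-- Here `T` bounds `k / φ(k)`. In `12 * T` a factor 2 comes from there being at least `m / 2`
-- moduli, `2 * T` from `φ(k) ≥ m / (2 T)`, and 3 from comparing loads within a cell.
expRH≤expReal : ∀ m n T X .{{_ : NonZero m}} .{{_ : NonZero n}} → n ≤ m → (∀ {x} → x ∈ X → x ≤ m) →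
  (∀ k .{{_ : NonZero k}} → k ≤ m → k ≤ T * length (units k)) →
  expRH m n X ℚ.≤ ℕtoℚ (12 * T) ℚ.* expReal n X
expRH≤expReal m n T X {{m≢0}} {{n≢0}} n≤m X≤m totient = *-cancelʳ-≤-ℕtoℚ M (begin
  Q ℚ.* ℕtoℚ M
    ≡⟨ cong (Q ℚ.*_) (trans (ℕtoℚ-* (m * m) w) (cong (ℚ._* ℕtoℚ w) (ℕtoℚ-* m m))) ⟩
  Q ℚ.* (ℕtoℚ m ℚ.* ℕtoℚ m ℚ.* ℕtoℚ w)
    ≡⟨ solve 3 (λ q m w → q :* (m :* m :* w) := w :* (m :* (q :* m))) refl Q (ℕtoℚ m) (ℕtoℚ w) ⟩
  ℕtoℚ w ℚ.* (ℕtoℚ m ℚ.* (Q ℚ.* ℕtoℚ m))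
    ≤⟨ *-monoˡ-≤-ℕtoℚ w (*-monoˡ-≤-ℕtoℚ m (rescale {Q} {sumℚ Es} {m} {length (halfRange m)} 2 0≤Q Q≡ (m≤2*length-halfRange m))) ⟩
  ℕtoℚ w ℚ.* (ℕtoℚ m ℚ.* (ℕtoℚ 2 ℚ.* sumℚ Es))
    ≡⟨ solve 4 (λ w m t s → w :* (m :* (t :* s)) := w :* (t :* (s :* m))) refl (ℕtoℚ w) (ℕtoℚ m) (ℕtoℚ 2) (sumℚ Es) ⟩
  ℕtoℚ w ℚ.* (ℕtoℚ 2 ℚ.* (sumℚ Es ℚ.* ℕtoℚ m))
    ≤⟨ *-monoˡ-≤-ℕtoℚ w (*-monoˡ-≤-ℕtoℚ 2 (sumℚ-bound (λ k → expSH k n X) (λ k → 2 * T * S k) m (halfRange m) modulus)) ⟩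
  ℕtoℚ w ℚ.* (ℕtoℚ 2 ℚ.* ℕtoℚ (∑ (halfRange m) (λ k → 2 * T * S k)))
    ≡⟨ trans (ℕtoℚ-* w (2 * ∑ (halfRange m) (λ k → 2 * T * S k))) (cong (ℕtoℚ w ℚ.*_) (ℕtoℚ-* 2 (∑ (halfRange m) (λ k → 2 * T * S k)))) ⟨
  ℕtoℚ (w * (2 * ∑ (halfRange m) (λ k → 2 * T * S k)))
    ≡⟨ cong (λ l → ℕtoℚ (w * (2 * l))) (∑-*ˡ (halfRange m) (2 * T) S) ⟩
  ℕtoℚ (w * (2 * (2 * T * ∑ (halfRange m) S)))        ≡⟨ cong ℕtoℚ (lem₁ w T (∑ (halfRange m) S)) ⟩
  ℕtoℚ (4 * T * (w * ∑ (halfRange m) S))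
    ≤⟨ ℕtoℚ-≤ {4 * T * (w * ∑ (halfRange m) S)} {4 * T * (3 * R)} (*-monoʳ-≤ (4 * T) (∑-SH≤∑-grid m n w X n≤m X≤m)) ⟩
  ℕtoℚ (4 * T * (3 * R))                              ≡⟨ cong ℕtoℚ (lem₂ T R) ⟩
  ℕtoℚ (12 * T * R)                                   ≡⟨ ℕtoℚ-* (12 * T) R ⟩
  ℕtoℚ (12 * T) ℚ.* ℕtoℚ R
    ≡⟨ cong (ℕtoℚ (12 * T) ℚ.*_) (expReal-grid n M X (λ x∈ x≢0 → ∣n⇒∣m*n (m * m) (*-monoʳ-∣ n (∈⇒∣! {{x≢0}} (X≤m x∈))))) ⟨
  ℕtoℚ (12 * T) ℚ.* (expReal n X ℚ.* ℕtoℚ M)          ≡⟨ ℚ.*-assoc (ℕtoℚ (12 * T)) (expReal n X) (ℕtoℚ M) ⟨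
  ℕtoℚ (12 * T) ℚ.* expReal n X ℚ.* ℕtoℚ M            ∎)
  where
  open ℚ.≤-Reasoning
  open +-*-Solver using (solve; _:*_; _:=_)
  w = n * m !
  M = m * m * w
  instance
    M≢0 : NonZero M
    M≢0 = m*n≢0 (m * m) w {{m*n≢0 m m}} {{m*n≢0 n (m !) {{n≢0}} {{m !≢0}}}}
  Q = expRH m n X
  Es = map (λ k → expSH k n X) (halfRange m)
  S : ℕ → ℕ
  S k = ∑ (units k) (λ c → maxload n (shBin n k c) X)
  R = ∑ (downFrom M) (λ l → maxload n (gridBin n M l) X)
  lem₁ : ∀ w T s → w * (2 * (2 * T * s)) ≡ 4 * T * (w * s)
  lem₁ = solve-∀
  lem₂ : ∀ T R → 4 * T * (3 * R) ≡ 12 * T * R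
  lem₂ = solve-∀
  0≤Q : 0ℚ ℚ.≤ Q
  0≤Q = 0≤avgℚ (λ k → expSH k n X) (halfRange m) (λ k → 0≤expSH k n X)
  Q≡ : Q ℚ.* ℕtoℚ (length (halfRange m)) ≡ sumℚ Es
  Q≡ = trans (cong (λ l → Q ℚ.* ℕtoℚ l) (sym (length-map (λ k → expSH k n X) (halfRange m)))) (avgℚ*length Es)
  modulus : ∀ {k} → k ∈ halfRange m → expSH k n X ℚ.* ℕtoℚ m ℚ.≤ ℕtoℚ (2 * T * S k)
  modulus {k} k∈ = ℚ.≤-trans (rescale {expSH k n X} {ℕtoℚ (S k)} {m} {length (units k)} (2 * T) (0≤expSH k n X) (expSH*length k n X) m≤)
    (ℚ.≤-reflexive (sym (ℕtoℚ-* (2 * T) (S k))))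
    where
    m≤ : m ≤ 2 * T * length (units k)
    m≤ = ≤-trans (proj₂ (halfRange-bounds m k∈))
      (≤-trans (*-monoʳ-≤ 2 (totient k {{halfRange-nonZero m k∈}} (proj₁ (halfRange-bounds m k∈)))) (≤-reflexive (sym (*-assoc 2 T _))))

-- Integer square roots and iterated logarithms

isqrt-lower : ∀ {r m} → r * r ≤ m → r ≤ isqrt m
isqrt-lower {r} {m} r²≤m = ≤-trans (≤-reflexive (sym length-roots)) (length-unique-⊆ (Unique.map⁺ suc-injective (Unique.downFrom⁺ r)) roots⊆)
  where
  length-roots : length (map suc (downFrom r)) ≡ r
  length-roots = trans (length-map suc (downFrom r)) (length-downFrom r)
  roots⊆ : ∀ {s} → s ∈ map suc (downFrom r) → s ∈ filter (λ s → s * s ≤? m) (applyUpTo suc m)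
  roots⊆ s∈ with ∈-map⁻ suc s∈
  ... | i , i∈ , refl = ∈-filter⁺ (λ s → s * s ≤? m) (∈-applyUpTo⁺ suc (≤-trans (m≤m*n (suc i) (suc i)) s²≤m)) s²≤m
    where
    s²≤m : suc i * suc i ≤ m
    s²≤m = ≤-trans (*-mono-≤ (∈-downFrom⁻ i∈) (∈-downFrom⁻ i∈)) r²≤m

isqrt-upper : ∀ {r m} → m ≤ r * r → isqrt m ≤ r
isqrt-upper {r} {m} m≤r² = ≤-trans (length-unique-⊆ (Unique.filter⁺ (λ s → s * s ≤? m) (Unique.applyUpTo⁺₁ suc m (λ i<j _ eq → <⇒≢ i<j (suc-injective eq)))) ⊆roots) (≤-reflexive length-roots)
  where
  length-roots : length (map suc (downFrom r)) ≡ r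
  length-roots = trans (length-map suc (downFrom r)) (length-downFrom r)
  ⊆roots : ∀ {s} → s ∈ filter (λ s → s * s ≤? m) (applyUpTo suc m) → s ∈ map suc (downFrom r)
  ⊆roots s∈ with ∈-filter⁻ (λ s → s * s ≤? m) {xs = applyUpTo suc m} s∈
  ... | s∈′ , s²≤m with ∈-applyUpTo⁻ suc s∈′
  ...   | i , _ , refl = ∈-map⁺ suc (∈-downFrom⁺ (≮⇒≥ λ r<s → <⇒≱ (*-mono-< r<s r<s) (≤-trans s²≤m m≤r²)))

n<2^n : ∀ n → n < 2 ^ n
n<2^n zero    = s≤s z≤n
n<2^n (suc n) = +-mono-≤ (m^n>0 2 n) (≤-trans (n<2^n n) (m≤m+n (2 ^ n) 0))

1≤loglog : ∀ {n} → 4 ≤ n → 1 ≤ loglog n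
1≤loglog 4≤n = ⌊log₂⌋-mono-≤ {2} (⌊log₂⌋-mono-≤ {4} 4≤n)

-- Taking logarithms twice turns the exponent `C` into an added `log C`, bounded here by `C`; the
-- floors in `loglog` account for the `suc`.
^≤2^2^ : ∀ n C → n ^ C ≤ 2 ^ (2 ^ (suc (loglog n) + C))
^≤2^2^ n C = begin
  n ^ C                            ≤⟨ ^-monoˡ-≤ C (<⇒≤ (n<2^[1+⌊log₂n⌋] n)) ⟩
  (2 ^ suc ⌊log₂ n ⌋) ^ C          ≡⟨ ^-*-assoc 2 (suc ⌊log₂ n ⌋) C ⟩
  2 ^ (suc ⌊log₂ n ⌋ * C)          ≤⟨ ^-monoʳ-≤ 2 (*-mono-≤ (n<2^[1+⌊log₂n⌋] ⌊log₂ n ⌋) (<⇒≤ (n<2^n C))) ⟩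
  2 ^ (2 ^ suc (loglog n) * 2 ^ C) ≡⟨ cong (2 ^_) (^-distribˡ-+-* 2 (suc (loglog n)) C) ⟨
  2 ^ (2 ^ (suc (loglog n) + C))   ∎
  where open ≤-Reasoning

-- The bounds for the maxima over all sets

M-RH≤ : ∀ C n u → 4 ≤ n → n ≤ u → u ≤ n ^ C → M-RH n u ℚ.≤ ℕtoℚ (192 * (3 + C) * loglog n) ℚ.* M-ℝ n u
M-RH≤ C n@(suc _) u 4≤n n≤u u≤ = maxℚ-map≤ (expRH m n) 0≤bound each
  where
  open ℚ.≤-Reasoning
  m = isqrt (n * u)
  K = 192 * (3 + C) * loglog n
  T = 16 * suc (suc (loglog n) + C)
  -- As `n ≤ u`, the root of `n * u` lies between `n` and `u`; therefore sets below `m` also compete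
  -- in `M-ℝ n u`.
  n≤m : n ≤ m
  n≤m = isqrt-lower (*-monoʳ-≤ n n≤u)
  m≤u : m ≤ u
  m≤u = isqrt-upper (*-monoˡ-≤ u n≤u)
  -- The left side is `192 * (loglog n + 2 + C)`, and `1 ≤ loglog n` lets the constant `2 + C` be
  -- multiplied by `loglog n`.
  12T≤K : 12 * T ≤ K
  12T≤K = ≤-trans (≤-reflexive (lem₁ (loglog n) C))
    (≤-trans (*-monoʳ-≤ 192 (≤-trans (+-monoʳ-≤ (loglog n) (*-monoʳ-≤ (2 + C) (1≤loglog 4≤n))) (≤-reflexive (lem₂ (loglog n) C))))
      (≤-reflexive (sym (*-assoc 192 (3 + C) (loglog n)))))
    where
    lem₁ : ∀ l C → 12 * (16 * suc (suc l + C)) ≡ 192 * (l + (2 + C) * 1)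
    lem₁ = solve-∀
    lem₂ : ∀ l C → l + (2 + C) * l ≡ (3 + C) * l
    lem₂ = solve-∀
  0≤bound : 0ℚ ℚ.≤ ℕtoℚ K ℚ.* M-ℝ n u
  0≤bound = ℚ.≤-trans (ℚ.≤-reflexive (sym (ℚ.*-zeroʳ (ℕtoℚ K)))) (*-monoˡ-≤-ℕtoℚ K (0≤maxℚ (map (expReal n) (subsetsOfSize n u))))
  each : ∀ {X} → X ∈ subsetsOfSize n m → expRH m n X ℚ.≤ ℕtoℚ K ℚ.* M-ℝ n u
  each {X} X∈ = begin
    expRH m n X
      ≤⟨ expRH≤expReal m n T X {{>-nonZero (≤-trans (s≤s z≤n) n≤m)}} n≤m (<⇒≤ ∘ subsetsOfSize-< n m X∈) (λ k k≤m → totient-lower (suc (loglog n) + C) k (≤-trans k≤m (≤-trans m≤u (≤-trans u≤ (^≤2^2^ n C))))) ⟩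
    ℕtoℚ (12 * T) ℚ.* expReal n X
      ≤⟨ *-monoˡ-≤-ℕtoℚ (12 * T) (∈⇒≤maxℚ (∈-map⁺ (expReal n) (subsetsOfSize-mono n m≤u X∈))) ⟩
    ℕtoℚ (12 * T) ℚ.* M-ℝ n u
      ≤⟨ ℚ.*-monoʳ-≤-nonNeg (M-ℝ n u) {{ℚ.nonNegative (0≤maxℚ (map (expReal n) (subsetsOfSize n u)))}} (ℕtoℚ-≤ {12 * T} {K} 12T≤K) ⟩
    ℕtoℚ K ℚ.* M-ℝ n u                 ∎

-- The power of two `k` with `k ≤ n * u < 2 * k` is one of the moduli over which `M-max` is taken.
M-ℝ≤ : ∀ n u → 2 ≤ n → n ≤ u → M-ℝ n u ℚ.≤ ℕtoℚ 9 ℚ.* M-max n u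
M-ℝ≤ n@(suc _) u 2≤n n≤u = maxℚ-map≤ (expReal n) 0≤bound (each (dyadic (pred (n * u))))
  where
  open ℚ.≤-Reasoning
  nu≡ : suc (pred (n * u)) ≡ n * u
  nu≡ = suc-pred (n * u) {{m*n≢0 n u {{_}} {{>-nonZero (≤-trans (s≤s z≤n) n≤u)}}}}
  moduli = filter (λ k → u <? k * k) (upTo (suc (n * u)))
  0≤bound : 0ℚ ℚ.≤ ℕtoℚ 9 ℚ.* M-max n u
  0≤bound = ℚ.≤-trans (ℚ.≤-reflexive (sym (ℚ.*-zeroʳ (ℕtoℚ 9)))) (*-monoˡ-≤-ℕtoℚ 9 (0≤maxℚ (map (λ k → M-SH k n) moduli)))
  2≤nu : 2 ≤ n * u
  2≤nu = ≤-trans (*-mono-≤ 2≤n (≤-trans (s≤s z≤n) n≤u)) ≤-refl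
  each : ∃[ e ] (2 ^ e ≤ suc (pred (n * u)) × suc (pred (n * u)) < 2 ^ suc e) → ∀ {X} → X ∈ subsetsOfSize n u → expReal n X ℚ.≤ ℕtoℚ 9 ℚ.* M-max n u
  -- Exponent 0 would mean `n * u < 2`; a positive exponent is what gives `k` the form `2 ^ suc e`.
  each (zero , _ , upper) _ = contradiction upper (≤⇒≯ (≤-trans 2≤nu (≤-reflexive (sym nu≡))))
  each (suc e , lower , upper) {X} X∈ = begin
    expReal n X                        ≤⟨ expReal≤expSH n u e X nu≤ (<⇒≤ ∘ subsetsOfSize-< n u X∈) ⟩
    ℕtoℚ 9 ℚ.* expSH k n X
      ≤⟨ *-monoˡ-≤-ℕtoℚ 9 (ℚ.≤-trans (∈⇒≤maxℚ (∈-map⁺ (expSH k n) (subsetsOfSize-mono n (<⇒≤ u<k) X∈))) (∈⇒≤maxℚ (∈-map⁺ (λ k → M-SH k n) k∈))) ⟩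
    ℕtoℚ 9 ℚ.* M-max n u               ∎
    where
    k = 2 ^ suc e
    lem : ∀ h → 2 * (2 * h) ≡ 4 * h
    lem = solve-∀
    nu<2k : n * u < 2 * k
    nu<2k = ≤-<-trans (≤-reflexive (sym nu≡)) upper
    nu≤ : n * u ≤ 4 * 2 ^ e
    nu≤ = ≤-trans (<⇒≤ nu<2k) (≤-reflexive (lem (2 ^ e)))
    -- From `2 * u ≤ n * u < 2 * k`. Hence sets below `u` are sets below `k`, and `k * k` exceeds
    -- `u`.
    u<k : u < k
    u<k = *-cancelˡ-< 2 u k (≤-<-trans (*-monoˡ-≤ u 2≤n) nu<2k)
    k∈ : k ∈ moduli
    k∈ = ∈-filter⁺ (λ k → u <? k * k) (∈-upTo⁺ (s≤s (≤-trans lower (≤-reflexive nu≡))))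
      (<-≤-trans u<k (m≤m*n k k {{m^n≢0 2 (suc e)}}))

mainTheorem4 : (C : ℕ) →
    ∃[ c₁ ] ∃[ c₂ ] (0ℚ <ℚ c₁ × 0ℚ <ℚ c₂ × ∃[ N ] ((n u : ℕ) → N ≤ n → n ^ 6 ≤ u → u ≤ n ^ C →
    (c₁ *ℚ M-RH n u ≤ℚ ℕtoℚ (loglog n) *ℚ M-ℝ n u) × (M-ℝ n u ≤ℚ c₂ *ℚ M-max n u)))
-- The constant `c₁` is the reciprocal of the factor in `M-RH≤`, which depends on `C`; the threshold
-- 4 ensures `1 ≤ loglog n`.
mainTheorem4 C = frac 1 K , ℕtoℚ 9 , ℚ.positive⁻¹ (frac 1 K) {{ℚ.normalize-pos 1 K}} , ℚ.positive⁻¹ (ℕtoℚ 9) , 4 ,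
  λ n u 4≤n n⁶≤u u≤nᶜ → lower n u 4≤n (n≤u n u 4≤n n⁶≤u) u≤nᶜ , M-ℝ≤ n u (≤-trans (s≤s (s≤s z≤n)) 4≤n) (n≤u n u 4≤n n⁶≤u)
  where
  K = 192 * (3 + C)
  n≤u : ∀ n u → 4 ≤ n → n ^ 6 ≤ u → n ≤ u
  n≤u n u 4≤n n⁶≤u = ≤-trans (m≤m*n n (n ^ 5) {{m^n≢0 n 5 {{>-nonZero (≤-trans (s≤s z≤n) 4≤n)}}}}) n⁶≤u
  lower : ∀ n u → 4 ≤ n → n ≤ u → u ≤ n ^ C → frac 1 K ℚ.* M-RH n u ℚ.≤ ℕtoℚ (loglog n) ℚ.* M-ℝ n u
  lower n u 4≤n n≤u u≤nᶜ = begin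
    frac 1 K ℚ.* M-RH n u
      ≤⟨ ℚ.*-monoˡ-≤-nonNeg (frac 1 K) {{ℚ.normalize-nonNeg 1 K}} (M-RH≤ C n u 4≤n n≤u u≤nᶜ) ⟩
    frac 1 K ℚ.* (ℕtoℚ (K * loglog n) ℚ.* M-ℝ n u)
      ≡⟨ cong (λ q → frac 1 K ℚ.* (q ℚ.* M-ℝ n u)) (ℕtoℚ-* K (loglog n)) ⟩
    frac 1 K ℚ.* (ℕtoℚ K ℚ.* ℕtoℚ (loglog n) ℚ.* M-ℝ n u)
      ≡⟨ solve 4 (λ a k l r → a :* (k :* l :* r) := a :* k :* (l :* r)) refl (frac 1 K) (ℕtoℚ K) (ℕtoℚ (loglog n)) (M-ℝ n u) ⟩
    frac 1 K ℚ.* ℕtoℚ K ℚ.* (ℕtoℚ (loglog n) ℚ.* M-ℝ n u)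
      ≡⟨ cong (ℚ._* (ℕtoℚ (loglog n) ℚ.* M-ℝ n u)) (frac*denominator 1 K) ⟩
    1ℚ ℚ.* (ℕtoℚ (loglog n) ℚ.* M-ℝ n u)                        ≡⟨ ℚ.*-identityˡ _ ⟩
    ℕtoℚ (loglog n) ℚ.* M-ℝ n u                                 ∎
    where
    open ℚ.≤-Reasoning
    open +-*-Solver using (solve; _:*_; _:=_)
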